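{- Every axiom of the theory $\mathbf{ACA_0}+\exists\mathfrak{U}$ is provable in $\mathbf{RCA_0}+\exists\mathfrak{U}$; that is, $\mathbf{RCA_0}+\exists\mathfrak{U}$ implies $\mathbf{ACA_0}+\exists\mathfrak{U}$.
   Context: $\mathcal{L}^2$ is the two-sorted language of second-order arithmetic (number variables lowercase, set variables uppercase), assumed to contain, for each second-order term $T$ and first-order term $t$, a second-order term $T_t$, with every theory including the axiom $s\in T_t\leftrightarrow (t,s)\in T$, where $(t,s)$ is a fixed quantifier-free pairing. $\mathcal{L}^{\mathfrak{U}}$ is $\mathcal{L}^2$ together with a unary predicate $\mathfrak{U}$ on second-order terms (written $T\in\mathfrak{U}$). The axioms $\exists\mathfrak{U}$ are: (1) $\forall X(X\in\mathfrak{U}\rightarrow\forall x\exists y>x\, (y\in X))$; (2) $\forall X,Y(X\in\mathfrak{U}\wedge Y\in\mathfrak{U}\rightarrow X\cap Y\in\mathfrak{U})$; (3) $\forall X,Y(X\in\mathfrak{U}\wedge X\subseteq Y\rightarrow Y\in\mathfrak{U})$; (4) $\forall X(X\in\mathfrak{U}\vee X^c\in\mathfrak{U})$. For a theory $T$ of second-order arithmetic, $T+\exists\mathfrak{U}$ is the $\mathcal{L}^{\mathfrak{U}}$-theory whose axioms are those of $T$ (with its axiom schemes instantiated by formulas of $\mathcal{L}^{\mathfrak{U}}$) together with $\exists\mathfrak{U}$. $\mathbf{RCA_0}$, $\mathbf{ACA_0}$ denote the usual subsystems of second-order arithmetic. -}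

module Defs where

-- Syntax and Hilbert-style classical provability for the two-sorted
-- language L^U of second-order arithmetic with the ultrafilter predicate U,
-- and the theories RCA0 + ∃U and ACA0 + ∃U (Simpson's axiomatisations,
-- with all schemes instantiated by L^U formulas).
-- Variables of both sorts are de Bruijn indices (separate index spaces).

open import Data.Nat using (ℕ; zero; suc)
open import Function using (id)

data Tm : Set where
  var : ℕ → Tm
  𝟘 𝟙 : Tm
  _⊕_ _⊗_ : Tm → Tm → Tm

infixl 6 _⊕_
infixl 7 _⊗_

-- second-order (set) terms: set variables and T_t
data STm : Set where
  svar : ℕ → STm
  _at_ : STm → Tm → STm

infixl 8 _at_

data Fm : Set where
  _≐_ _≺_ : Tm → Tm → Fm
  _∈ₛ_ : Tm → STm → Fm
  𝔘∋_ : STm → Fm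
  ⊥ᶠ : Fm
  _⇒_ : Fm → Fm → Fm
  ∀ⁿ ∀ˢ : Fm → Fm

infix 5 _≐_ _≺_ _∈ₛ_ 𝔘∋_
infixr 2 _⇒_

¬ᶠ_ : Fm → Fm
¬ᶠ φ = φ ⇒ ⊥ᶠ

infix 4 ¬ᶠ_

_∨ᶠ_ : Fm → Fm → Fm
φ ∨ᶠ ψ = (¬ᶠ φ) ⇒ ψ

_∧ᶠ_ : Fm → Fm → Fm
φ ∧ᶠ ψ = ¬ᶠ (φ ⇒ ¬ᶠ ψ)

infixr 3 _∧ᶠ_ _∨ᶠ_

_⇔_ : Fm → Fm → Fm
φ ⇔ ψ = (φ ⇒ ψ) ∧ᶠ (ψ ⇒ φ)

infix 1 _⇔_

∃ⁿ : Fm → Fm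
∃ⁿ φ = ¬ᶠ ∀ⁿ (¬ᶠ φ)

∃ˢ : Fm → Fm
∃ˢ φ = ¬ᶠ ∀ˢ (¬ᶠ φ)

ext : (ℕ → ℕ) → ℕ → ℕ
ext ρ zero = zero
ext ρ (suc k) = suc (ρ k)

renT : (ℕ → ℕ) → Tm → Tm
renT ρ (var k) = var (ρ k)
renT ρ 𝟘 = 𝟘
renT ρ 𝟙 = 𝟙
renT ρ (t ⊕ s) = renT ρ t ⊕ renT ρ s
renT ρ (t ⊗ s) = renT ρ t ⊗ renT ρ s

renST : (ℕ → ℕ) → (ℕ → ℕ) → STm → STm
renST ρ π (svar k) = svar (π k)
renST ρ π (T at t) = renST ρ π T at renT ρ t

renF : (ℕ → ℕ) → (ℕ → ℕ) → Fm → Fm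
renF ρ π (t ≐ s) = renT ρ t ≐ renT ρ s
renF ρ π (t ≺ s) = renT ρ t ≺ renT ρ s
renF ρ π (t ∈ₛ T) = renT ρ t ∈ₛ renST ρ π T
renF ρ π (𝔘∋ T) = 𝔘∋ renST ρ π T
renF ρ π ⊥ᶠ = ⊥ᶠ
renF ρ π (φ ⇒ ψ) = renF ρ π φ ⇒ renF ρ π ψ
renF ρ π (∀ⁿ φ) = ∀ⁿ (renF (ext ρ) π φ)
renF ρ π (∀ˢ φ) = ∀ˢ (renF ρ (ext π) φ)

shiftN : Fm → Fm
shiftN = renF suc id

shiftS : Fm → Fm
shiftS = renF id suc

subT : (ℕ → Tm) → Tm → Tm
subT σ (var k) = σ k
subT σ 𝟘 = 𝟘
subT σ 𝟙 = 𝟙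
subT σ (t ⊕ s) = subT σ t ⊕ subT σ s
subT σ (t ⊗ s) = subT σ t ⊗ subT σ s

subST : (ℕ → Tm) → (ℕ → STm) → STm → STm
subST σ τ (svar k) = τ k
subST σ τ (T at t) = subST σ τ T at subT σ t

liftNn : (ℕ → Tm) → ℕ → Tm
liftNn σ zero = var zero
liftNn σ (suc k) = renT suc (σ k)

liftNs : (ℕ → STm) → ℕ → STm
liftNs τ k = renST suc id (τ k)

liftSs : (ℕ → STm) → ℕ → STm
liftSs τ zero = svar zero
liftSs τ (suc k) = renST id suc (τ k)

subF : (ℕ → Tm) → (ℕ → STm) → Fm → Fm
subF σ τ (t ≐ s) = subT σ t ≐ subT σ s
subF σ τ (t ≺ s) = subT σ t ≺ subT σ s
subF σ τ (t ∈ₛ T) = subT σ t ∈ₛ subST σ τ T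
subF σ τ (𝔘∋ T) = 𝔘∋ subST σ τ T
subF σ τ ⊥ᶠ = ⊥ᶠ
subF σ τ (φ ⇒ ψ) = subF σ τ φ ⇒ subF σ τ ψ
subF σ τ (∀ⁿ φ) = ∀ⁿ (subF (liftNn σ) (liftNs τ) φ)
subF σ τ (∀ˢ φ) = ∀ˢ (subF σ (liftSs τ) φ)

consN : Tm → (ℕ → Tm) → ℕ → Tm
consN t σ zero = t
consN t σ (suc k) = σ k

_[_]ⁿ : Fm → Tm → Fm
φ [ t ]ⁿ = subF (consN t var) svar φ

consS : STm → (ℕ → STm) → ℕ → STm
consS T τ zero = T
consS T τ (suc k) = τ k

_[_]ˢ : Fm → STm → Fm
φ [ T ]ˢ = subF var (consS T svar) φ

-- φ(n+1) from φ(n), where n is number variable 0 (no other variable changes)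
succSub : Fm → Fm
succSub φ = subF (consN (var zero ⊕ 𝟙) (λ k → var (suc k))) svar φ

-- bounded (Σ⁰₀) formulas: no set quantifiers, only bounded number
-- quantifiers ∀n (n < t → φ) with n not occurring in t
data Δ₀ : Fm → Set where
  eqA : ∀ t s → Δ₀ (t ≐ s)
  ltA : ∀ t s → Δ₀ (t ≺ s)
  memA : ∀ t T → Δ₀ (t ∈ₛ T)
  uA : ∀ T → Δ₀ (𝔘∋ T)
  botA : Δ₀ ⊥ᶠ
  impA : ∀ {φ ψ} → Δ₀ φ → Δ₀ ψ → Δ₀ (φ ⇒ ψ)
  bddA : ∀ t {φ} → Δ₀ φ → Δ₀ (∀ⁿ ((var zero ≺ renT suc t) ⇒ φ))

data Σ⁰₁ : Fm → Set where
  σ₁ : ∀ {θ} → Δ₀ θ → Σ⁰₁ (∃ⁿ θ)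

data Π⁰₁ : Fm → Set where
  π₁ : ∀ {θ} → Δ₀ θ → Π⁰₁ (∀ⁿ θ)

data Arith : Fm → Set where
  eqA : ∀ t s → Arith (t ≐ s)
  ltA : ∀ t s → Arith (t ≺ s)
  memA : ∀ t T → Arith (t ∈ₛ T)
  uA : ∀ T → Arith (𝔘∋ T)
  botA : Arith ⊥ᶠ
  impA : ∀ {φ ψ} → Arith φ → Arith ψ → Arith (φ ⇒ ψ)
  allA : ∀ {φ} → Arith φ → Arith (∀ⁿ φ)

pair : Tm → Tm → Tm
pair t s = (t ⊕ s) ⊗ (t ⊕ s) ⊕ t

-- basic axioms (Simpson), as universal closures; m = var 0, n = var 1
data Basic : Fm → Set where
  b1 : Basic (∀ⁿ (¬ᶠ (var zero ⊕ 𝟙 ≐ 𝟘)))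
  b2 : Basic (∀ⁿ (∀ⁿ ((var zero ⊕ 𝟙 ≐ var 1 ⊕ 𝟙) ⇒ (var zero ≐ var 1))))
  b3 : Basic (∀ⁿ (var zero ⊕ 𝟘 ≐ var zero))
  b4 : Basic (∀ⁿ (∀ⁿ (var zero ⊕ (var 1 ⊕ 𝟙) ≐ (var zero ⊕ var 1) ⊕ 𝟙)))
  b5 : Basic (∀ⁿ (var zero ⊗ 𝟘 ≐ 𝟘))
  b6 : Basic (∀ⁿ (∀ⁿ (var zero ⊗ (var 1 ⊕ 𝟙) ≐ (var zero ⊗ var 1) ⊕ var zero)))
  b7 : Basic (∀ⁿ (¬ᶠ (var zero ≺ 𝟘)))
  b8 : Basic (∀ⁿ (∀ⁿ ((var zero ≺ var 1 ⊕ 𝟙) ⇔ ((var zero ≺ var 1) ∨ᶠ (var zero ≐ var 1)))))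

data PairAx : Fm → Set where
  pairAx : ∀ T t s → PairAx ((s ∈ₛ (T at t)) ⇔ (pair t s ∈ₛ T))

-- the axioms ∃U; X ∩ Y and X^c are read via their defining properties
data UltraAx : Fm → Set where
  -- (1) ∀X (X ∈ U → ∀x ∃y > x (y ∈ X))
  u1 : UltraAx (∀ˢ (𝔘∋ svar zero ⇒ ∀ⁿ (∃ⁿ ((var 1 ≺ var zero) ∧ᶠ (var zero ∈ₛ svar zero)))))
  -- (2) ∀X,Y (X ∈ U ∧ Y ∈ U → X ∩ Y ∈ U)
  u2 : UltraAx (∀ˢ (∀ˢ ((𝔘∋ svar 1 ∧ᶠ 𝔘∋ svar zero) ⇒
         ∀ˢ (∀ⁿ ((var zero ∈ₛ svar zero) ⇔ ((var zero ∈ₛ svar 2) ∧ᶠ (var zero ∈ₛ svar 1)))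
             ⇒ 𝔘∋ svar zero))))
  -- (3) ∀X,Y (X ∈ U ∧ X ⊆ Y → Y ∈ U)
  u3 : UltraAx (∀ˢ (∀ˢ ((𝔘∋ svar 1 ∧ᶠ ∀ⁿ ((var zero ∈ₛ svar 1) ⇒ (var zero ∈ₛ svar zero)))
         ⇒ 𝔘∋ svar zero)))
  -- (4) ∀X (X ∈ U ∨ X^c ∈ U)
  u4 : UltraAx (∀ˢ (𝔘∋ svar zero ∨ᶠ
         ∀ˢ (∀ⁿ ((var zero ∈ₛ svar zero) ⇔ (¬ᶠ (var zero ∈ₛ svar 1))) ⇒ 𝔘∋ svar zero)))

data RCA₀U : Fm → Set where
  basic : ∀ {φ} → Basic φ → RCA₀U φ
  pairing : ∀ {φ} → PairAx φ → RCA₀U φ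
  ultra : ∀ {φ} → UltraAx φ → RCA₀U φ
  -- Σ⁰₁ induction (φ an L^U formula, n = number variable 0, parameters free)
  Σ₁-ind : ∀ {φ} → Σ⁰₁ φ →
    RCA₀U (((φ [ 𝟘 ]ⁿ) ∧ᶠ ∀ⁿ (φ ⇒ succSub φ)) ⇒ ∀ⁿ φ)
  -- Δ⁰₁ comprehension (X not free in φ: enforced by shiftS)
  Δ₁-comp : ∀ {φ ψ} → Σ⁰₁ φ → Π⁰₁ ψ →
    RCA₀U (∀ⁿ (φ ⇔ ψ) ⇒ ∃ˢ (∀ⁿ ((var zero ∈ₛ svar zero) ⇔ shiftS φ)))

data ACA₀U : Fm → Set where
  basic : ∀ {φ} → Basic φ → ACA₀U φ
  pairing : ∀ {φ} → PairAx φ → ACA₀U φ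
  ultra : ∀ {φ} → UltraAx φ → ACA₀U φ
  set-ind : ACA₀U (∀ˢ (((𝟘 ∈ₛ svar zero) ∧ᶠ
              ∀ⁿ ((var zero ∈ₛ svar zero) ⇒ (var zero ⊕ 𝟙 ∈ₛ svar zero)))
              ⇒ ∀ⁿ (var zero ∈ₛ svar zero)))
  arith-comp : ∀ {φ} → Arith φ →
    ACA₀U (∃ˢ (∀ⁿ ((var zero ∈ₛ svar zero) ⇔ shiftS φ)))

-- Classical two-sorted Hilbert calculus; Γ ⊢ φ : φ is provable from
-- the axioms Γ (free variables read universally).

infix 0 _⊢_

data _⊢_ (Γ : Fm → Set) : Fm → Set where
  ax : ∀ {φ} → Γ φ → Γ ⊢ φ
  mp : ∀ {φ ψ} → Γ ⊢ φ ⇒ ψ → Γ ⊢ φ → Γ ⊢ ψ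
  K : ∀ {φ ψ} → Γ ⊢ φ ⇒ ψ ⇒ φ
  S : ∀ {φ ψ χ} → Γ ⊢ (φ ⇒ ψ ⇒ χ) ⇒ (φ ⇒ ψ) ⇒ φ ⇒ χ
  DNE : ∀ {φ} → Γ ⊢ ¬ᶠ (¬ᶠ φ) ⇒ φ
  genⁿ : ∀ {φ} → Γ ⊢ φ → Γ ⊢ ∀ⁿ φ
  instⁿ : ∀ {φ} t → Γ ⊢ ∀ⁿ φ ⇒ φ [ t ]ⁿ
  distⁿ : ∀ {φ ψ} → Γ ⊢ ∀ⁿ (shiftN ψ ⇒ φ) ⇒ ψ ⇒ ∀ⁿ φ
  genˢ : ∀ {φ} → Γ ⊢ φ → Γ ⊢ ∀ˢ φ
  instˢ : ∀ {φ} T → Γ ⊢ ∀ˢ φ ⇒ φ [ T ]ˢ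
  distˢ : ∀ {φ ψ} → Γ ⊢ ∀ˢ (shiftS ψ ⇒ φ) ⇒ ψ ⇒ ∀ˢ φ
  eq-refl : ∀ t → Γ ⊢ t ≐ t
  eq-subst : ∀ {φ} t s → Γ ⊢ (t ≐ s) ⇒ (φ [ t ]ⁿ) ⇒ (φ [ s ]ⁿ)

-- Over RCA₀ every Δ₀ formula χ(x⃗, y) of L^𝔘, 𝔘-atoms included, is defined by a single set X
-- uniformly in its parameters, y ∈ (X_{x_N})…_{x₁} ↔ χ(x⃗, y): Δ⁰₁ comprehension for the Δ₀ formula
-- "p codes a pair (x, y) with χ(x, y)" together with the pairing axiom y ∈ X_x ↔ (x,y) ∈ X removes
-- the parameters one at a time. The ultrafilter turns a universal quantifier into an atom:
-- ∀ m (m ∈ X) holds iff {n ∣ ∃ m < n . m ∉ X} ∉ 𝔘. So, by induction on an arithmetical formula,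
-- each subformula is defined by a set obtained by Δ₀ comprehension from the sets of its immediate
-- subformulas. Set induction is an instance of Σ⁰₁ induction.

module Submission where

open import Defs
open import Data.Nat using (ℕ; zero; suc)
open import Data.List using (List; []; _∷_; map)
open import Data.List.Membership.Propositional using (_∈_)
open import Data.List.Relation.Unary.Any using (here; there)
open import Function using (id; _∘_)
open import Relation.Binary.PropositionalEquality


subT-cong : ∀ {σ σ′} → (∀ k → σ k ≡ σ′ k) → ∀ t → subT σ t ≡ subT σ′ t
subT-cong e (var k) = e k
subT-cong e 𝟘 = refl
subT-cong e 𝟙 = refl
subT-cong e (t ⊕ s) = cong₂ _⊕_ (subT-cong e t) (subT-cong e s)
subT-cong e (t ⊗ s) = cong₂ _⊗_ (subT-cong e t) (subT-cong e s)

renT≡subT : ∀ ρ t → renT ρ t ≡ subT (var ∘ ρ) t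
renT≡subT ρ (var k) = refl
renT≡subT ρ 𝟘 = refl
renT≡subT ρ 𝟙 = refl
renT≡subT ρ (t ⊕ s) = cong₂ _⊕_ (renT≡subT ρ t) (renT≡subT ρ s)
renT≡subT ρ (t ⊗ s) = cong₂ _⊗_ (renT≡subT ρ t) (renT≡subT ρ s)

subT-subT : ∀ σ′ σ t → subT σ′ (subT σ t) ≡ subT (subT σ′ ∘ σ) t
subT-subT σ′ σ (var k) = refl
subT-subT σ′ σ 𝟘 = refl
subT-subT σ′ σ 𝟙 = refl
subT-subT σ′ σ (t ⊕ s) = cong₂ _⊕_ (subT-subT σ′ σ t) (subT-subT σ′ σ s)
subT-subT σ′ σ (t ⊗ s) = cong₂ _⊗_ (subT-subT σ′ σ t) (subT-subT σ′ σ s)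

subT-id : ∀ t → subT var t ≡ t
subT-id (var k) = refl
subT-id 𝟘 = refl
subT-id 𝟙 = refl
subT-id (t ⊕ s) = cong₂ _⊕_ (subT-id t) (subT-id s)
subT-id (t ⊗ s) = cong₂ _⊗_ (subT-id t) (subT-id s)

subST-cong : ∀ {σ σ′ τ τ′} → (∀ k → σ k ≡ σ′ k) → (∀ k → τ k ≡ τ′ k) →
             ∀ T → subST σ τ T ≡ subST σ′ τ′ T
subST-cong e f (svar k) = f k
subST-cong e f (T at t) = cong₂ _at_ (subST-cong e f T) (subT-cong e t)

renST≡subST : ∀ ρ π T → renST ρ π T ≡ subST (var ∘ ρ) (svar ∘ π) T
renST≡subST ρ π (svar k) = refl
renST≡subST ρ π (T at t) = cong₂ _at_ (renST≡subST ρ π T) (renT≡subT ρ t)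

subST-subST : ∀ σ′ τ′ σ τ T → subST σ′ τ′ (subST σ τ T) ≡ subST (subT σ′ ∘ σ) (subST σ′ τ′ ∘ τ) T
subST-subST σ′ τ′ σ τ (svar k) = refl
subST-subST σ′ τ′ σ τ (T at t) = cong₂ _at_ (subST-subST σ′ τ′ σ τ T) (subT-subT σ′ σ t)

subST-id : ∀ T → subST var svar T ≡ T
subST-id (svar k) = refl
subST-id (T at t) = cong₂ _at_ (subST-id T) (subT-id t)

subT-consN-renT-suc : ∀ t u → subT (consN t var) (renT suc u) ≡ u
subT-consN-renT-suc t u =
  trans (cong (subT (consN t var)) (renT≡subT suc u)) (trans (subT-subT _ _ u) (subT-id u))

subST-consN-renST-suc : ∀ t T → subST (consN t var) svar (renST suc id T) ≡ T
subST-consN-renST-suc t T =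
  trans (cong (subST (consN t var) svar) (renST≡subST suc id T)) (trans (subST-subST _ _ _ _ T) (subST-id T))

subST-consS-renST-suc : ∀ T U → subST var (consS T svar) (renST id suc U) ≡ U
subST-consS-renST-suc T U =
  trans (cong (subST var (consS T svar)) (renST≡subST id suc U)) (trans (subST-subST _ _ _ _ U) (subST-id U))

subT-liftNn-renT-suc : ∀ σ t → subT (liftNn σ) (renT suc t) ≡ renT suc (subT σ t)
subT-liftNn-renT-suc σ (var k) = refl
subT-liftNn-renT-suc σ 𝟘 = refl
subT-liftNn-renT-suc σ 𝟙 = refl
subT-liftNn-renT-suc σ (t ⊕ s) = cong₂ _⊕_ (subT-liftNn-renT-suc σ t) (subT-liftNn-renT-suc σ s)
subT-liftNn-renT-suc σ (t ⊗ s) = cong₂ _⊗_ (subT-liftNn-renT-suc σ t) (subT-liftNn-renT-suc σ s)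

subST-liftN-renST-suc : ∀ σ τ T → subST (liftNn σ) (liftNs τ) (renST suc id T) ≡ renST suc id (subST σ τ T)
subST-liftN-renST-suc σ τ (svar k) = refl
subST-liftN-renST-suc σ τ (T at t) = cong₂ _at_ (subST-liftN-renST-suc σ τ T) (subT-liftNn-renT-suc σ t)

liftNn-cong : ∀ {σ σ′} → (∀ k → σ k ≡ σ′ k) → ∀ k → liftNn σ k ≡ liftNn σ′ k
liftNn-cong e zero = refl
liftNn-cong e (suc k) = cong (renT suc) (e k)

liftSs-cong : ∀ {τ τ′} → (∀ k → τ k ≡ τ′ k) → ∀ k → liftSs τ k ≡ liftSs τ′ k
liftSs-cong f zero = refl
liftSs-cong f (suc k) = cong (renST id suc) (f k)

subF-cong : ∀ {σ σ′ τ τ′} → (∀ k → σ k ≡ σ′ k) → (∀ k → τ k ≡ τ′ k) →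
            ∀ φ → subF σ τ φ ≡ subF σ′ τ′ φ
subF-cong e f (t ≐ s) = cong₂ _≐_ (subT-cong e t) (subT-cong e s)
subF-cong e f (t ≺ s) = cong₂ _≺_ (subT-cong e t) (subT-cong e s)
subF-cong e f (t ∈ₛ T) = cong₂ _∈ₛ_ (subT-cong e t) (subST-cong e f T)
subF-cong e f (𝔘∋ T) = cong 𝔘∋_ (subST-cong e f T)
subF-cong e f ⊥ᶠ = refl
subF-cong e f (φ ⇒ ψ) = cong₂ _⇒_ (subF-cong e f φ) (subF-cong e f ψ)
subF-cong e f (∀ⁿ φ) = cong ∀ⁿ (subF-cong (liftNn-cong e) (cong (renST suc id) ∘ f) φ)
subF-cong e f (∀ˢ φ) = cong ∀ˢ (subF-cong e (liftSs-cong f) φ)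

renF≡subF : ∀ ρ π φ → renF ρ π φ ≡ subF (var ∘ ρ) (svar ∘ π) φ
renF≡subF ρ π (t ≐ s) = cong₂ _≐_ (renT≡subT ρ t) (renT≡subT ρ s)
renF≡subF ρ π (t ≺ s) = cong₂ _≺_ (renT≡subT ρ t) (renT≡subT ρ s)
renF≡subF ρ π (t ∈ₛ T) = cong₂ _∈ₛ_ (renT≡subT ρ t) (renST≡subST ρ π T)
renF≡subF ρ π (𝔘∋ T) = cong 𝔘∋_ (renST≡subST ρ π T)
renF≡subF ρ π ⊥ᶠ = refl
renF≡subF ρ π (φ ⇒ ψ) = cong₂ _⇒_ (renF≡subF ρ π φ) (renF≡subF ρ π ψ)
renF≡subF ρ π (∀ⁿ φ) = cong ∀ⁿ (trans (renF≡subF (ext ρ) π φ) (subF-cong var-ext (λ _ → refl) φ))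
  where
  var-ext : ∀ k → var (ext ρ k) ≡ liftNn (var ∘ ρ) k
  var-ext zero = refl
  var-ext (suc k) = refl
renF≡subF ρ π (∀ˢ φ) = cong ∀ˢ (trans (renF≡subF ρ (ext π) φ) (subF-cong (λ _ → refl) svar-ext φ))
  where
  svar-ext : ∀ k → svar (ext π k) ≡ liftSs (svar ∘ π) k
  svar-ext zero = refl
  svar-ext (suc k) = refl

subF-subF : ∀ σ′ τ′ σ τ φ → subF σ′ τ′ (subF σ τ φ) ≡ subF (subT σ′ ∘ σ) (subST σ′ τ′ ∘ τ) φ
subF-subF σ′ τ′ σ τ (t ≐ s) = cong₂ _≐_ (subT-subT σ′ σ t) (subT-subT σ′ σ s)
subF-subF σ′ τ′ σ τ (t ≺ s) = cong₂ _≺_ (subT-subT σ′ σ t) (subT-subT σ′ σ s)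
subF-subF σ′ τ′ σ τ (t ∈ₛ T) = cong₂ _∈ₛ_ (subT-subT σ′ σ t) (subST-subST σ′ τ′ σ τ T)
subF-subF σ′ τ′ σ τ (𝔘∋ T) = cong 𝔘∋_ (subST-subST σ′ τ′ σ τ T)
subF-subF σ′ τ′ σ τ ⊥ᶠ = refl
subF-subF σ′ τ′ σ τ (φ ⇒ ψ) = cong₂ _⇒_ (subF-subF σ′ τ′ σ τ φ) (subF-subF σ′ τ′ σ τ ψ)
subF-subF σ′ τ′ σ τ (∀ⁿ φ) =
  cong ∀ⁿ (trans (subF-subF (liftNn σ′) (liftNs τ′) (liftNn σ) (liftNs τ) φ) (subF-cong lift-n lift-s φ))
  where
  lift-n : ∀ k → subT (liftNn σ′) (liftNn σ k) ≡ liftNn (subT σ′ ∘ σ) k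
  lift-n zero = refl
  lift-n (suc k) = subT-liftNn-renT-suc σ′ (σ k)
  lift-s : ∀ k → subST (liftNn σ′) (liftNs τ′) (liftNs τ k) ≡ liftNs (subST σ′ τ′ ∘ τ) k
  lift-s k = subST-liftN-renST-suc σ′ τ′ (τ k)
subF-subF σ′ τ′ σ τ (∀ˢ φ) =
  cong ∀ˢ (trans (subF-subF σ′ (liftSs τ′) σ (liftSs τ) φ) (subF-cong (λ _ → refl) lift-s φ))
  where
  lift-s : ∀ k → subST σ′ (liftSs τ′) (liftSs τ k) ≡ liftSs (subST σ′ τ′ ∘ τ) k
  lift-s zero = refl
  lift-s (suc k) = begin
    subST σ′ (liftSs τ′) (renST id suc (τ k))
      ≡⟨ cong (subST σ′ (liftSs τ′)) (renST≡subST id suc (τ k)) ⟩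
    subST σ′ (liftSs τ′) (subST var (svar ∘ suc) (τ k))
      ≡⟨ subST-subST σ′ (liftSs τ′) var (svar ∘ suc) (τ k) ⟩
    subST (subT σ′ ∘ var) (renST id suc ∘ τ′) (τ k)
      ≡⟨ subST-cong (λ j → sym (subT-id (σ′ j))) (λ j → renST≡subST id suc (τ′ j)) (τ k) ⟩
    subST (subT var ∘ σ′) (subST var (svar ∘ suc) ∘ τ′) (τ k)
      ≡⟨ sym (subST-subST var (svar ∘ suc) σ′ τ′ (τ k)) ⟩
    subST var (svar ∘ suc) (subST σ′ τ′ (τ k))
      ≡⟨ sym (renST≡subST id suc (subST σ′ τ′ (τ k))) ⟩
    renST id suc (subST σ′ τ′ (τ k)) ∎
    where open ≡-Reasoning

subF-id : ∀ φ → subF var svar φ ≡ φ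
subF-id (t ≐ s) = cong₂ _≐_ (subT-id t) (subT-id s)
subF-id (t ≺ s) = cong₂ _≺_ (subT-id t) (subT-id s)
subF-id (t ∈ₛ T) = cong₂ _∈ₛ_ (subT-id t) (subST-id T)
subF-id (𝔘∋ T) = cong 𝔘∋_ (subST-id T)
subF-id ⊥ᶠ = refl
subF-id (φ ⇒ ψ) = cong₂ _⇒_ (subF-id φ) (subF-id ψ)
subF-id (∀ⁿ φ) = cong ∀ⁿ (trans (subF-cong liftNn-var (λ _ → refl) φ) (subF-id φ))
  where
  liftNn-var : ∀ k → liftNn var k ≡ var k
  liftNn-var zero = refl
  liftNn-var (suc k) = refl
subF-id (∀ˢ φ) = cong ∀ˢ (trans (subF-cong (λ _ → refl) liftSs-svar φ) (subF-id φ))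
  where
  liftSs-svar : ∀ k → liftSs svar k ≡ svar k
  liftSs-svar zero = refl
  liftSs-svar (suc k) = refl

subF-subF-cong : ∀ σ′ τ′ σ τ ϱ′ υ′ ϱ υ φ →
  (∀ k → subT σ′ (σ k) ≡ subT ϱ′ (ϱ k)) → (∀ k → subST σ′ τ′ (τ k) ≡ subST ϱ′ υ′ (υ k)) →
  subF σ′ τ′ (subF σ τ φ) ≡ subF ϱ′ υ′ (subF ϱ υ φ)
subF-subF-cong σ′ τ′ σ τ ϱ′ υ′ ϱ υ φ e f =
  trans (subF-subF σ′ τ′ σ τ φ) (trans (subF-cong e f φ) (sym (subF-subF ϱ′ υ′ ϱ υ φ)))

shiftN-[]ⁿ : ∀ t φ → shiftN φ [ t ]ⁿ ≡ φ
shiftN-[]ⁿ t φ = trans (cong (subF (consN t var) svar) (renF≡subF suc id φ))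
  (trans (subF-subF (consN t var) svar (var ∘ suc) svar φ) (subF-id φ))

subF-shiftN : ∀ σ τ φ → subF (liftNn σ) (liftNs τ) (shiftN φ) ≡ shiftN (subF σ τ φ)
subF-shiftN σ τ φ = trans (cong (subF (liftNn σ) (liftNs τ)) (renF≡subF suc id φ))
  (trans (subF-subF-cong _ _ (var ∘ suc) svar (var ∘ suc) svar σ τ φ
            (λ k → renT≡subT suc (σ k)) (λ k → renST≡subST suc id (τ k)))
   (sym (renF≡subF suc id (subF σ τ φ))))

subF-shiftS : ∀ σ τ φ → subF σ (liftSs τ) (shiftS φ) ≡ shiftS (subF σ τ φ)
subF-shiftS σ τ φ = trans (cong (subF σ (liftSs τ)) (renF≡subF id suc φ))
  (trans (subF-subF-cong _ _ var (svar ∘ suc) var (svar ∘ suc) σ τ φ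
            (λ k → sym (subT-id (σ k))) (λ k → renST≡subST id suc (τ k)))
   (sym (renF≡subF id suc (subF σ τ φ))))

subF-liftN-shiftS : ∀ σ τ φ →
  subF (liftNn σ) (liftNs (liftSs τ)) (shiftS φ) ≡ shiftS (subF (liftNn σ) (liftNs τ) φ)
subF-liftN-shiftS σ τ φ = trans (cong (subF (liftNn σ) (liftNs (liftSs τ))) (renF≡subF id suc φ))
  (trans (subF-subF-cong _ _ var (svar ∘ suc) var (svar ∘ suc) (liftNn σ) (liftNs τ) φ
            (λ k → sym (subT-id (liftNn σ k))) shift-comm)
   (sym (renF≡subF id suc (subF (liftNn σ) (liftNs τ) φ))))
  where
  shift-comm : ∀ k → renST suc id (renST id suc (τ k)) ≡ subST var (svar ∘ suc) (liftNs τ k)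
  shift-comm k = trans (cong (renST suc id) (renST≡subST id suc (τ k)))
    (trans (renST≡subST suc id _) (trans (subST-subST _ _ _ _ (τ k))
    (sym (trans (cong (subST var (svar ∘ suc)) (renST≡subST suc id (τ k))) (subST-subST _ _ _ _ (τ k))))))

subF-[]ⁿ : ∀ σ τ t φ → subF σ τ (φ [ t ]ⁿ) ≡ (subF (liftNn σ) (liftNs τ) φ) [ subT σ t ]ⁿ
subF-[]ⁿ σ τ t φ = subF-subF-cong _ _ (consN t var) svar _ _ (liftNn σ) (liftNs τ) φ inst-n inst-s
  where
  inst-n : ∀ k → subT σ (consN t var k) ≡ subT (consN (subT σ t) var) (liftNn σ k)
  inst-n zero = refl
  inst-n (suc k) = sym (subT-consN-renT-suc (subT σ t) (σ k))
  inst-s : ∀ k → τ k ≡ subST (consN (subT σ t) var) svar (liftNs τ k)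
  inst-s k = sym (subST-consN-renST-suc (subT σ t) (τ k))

subF-[]ˢ : ∀ σ τ T φ → subF σ τ (φ [ T ]ˢ) ≡ (subF σ (liftSs τ) φ) [ subST σ τ T ]ˢ
subF-[]ˢ σ τ T φ = subF-subF-cong _ _ var (consS T svar) _ _ σ (liftSs τ) φ inst-n inst-s
  where
  inst-n : ∀ k → σ k ≡ subT var (σ k)
  inst-n k = sym (subT-id (σ k))
  inst-s : ∀ k → subST σ τ (consS T svar k) ≡ subST var (consS (subST σ τ T) svar) (liftSs τ k)
  inst-s zero = refl
  inst-s (suc k) = sym (subST-consS-renST-suc (subST σ τ T) (τ k))

subF-succSub : ∀ σ τ φ → subF (liftNn σ) (liftNs τ) (succSub φ) ≡ succSub (subF (liftNn σ) (liftNs τ) φ)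
subF-succSub σ τ φ = subF-subF-cong _ _ step svar _ _ (liftNn σ) (liftNs τ) φ step-n step-s
  where
  step : ℕ → Tm
  step = consN (var zero ⊕ 𝟙) (var ∘ suc)
  step-n : ∀ k → subT (liftNn σ) (step k) ≡ subT step (liftNn σ k)
  step-n zero = refl
  step-n (suc k) = trans (renT≡subT suc (σ k)) (sym (trans (cong (subT step) (renT≡subT suc (σ k)))
    (subT-subT step (var ∘ suc) (σ k))))
  step-s : ∀ k → liftNs τ k ≡ subST step svar (liftNs τ k)
  step-s k = trans (renST≡subST suc id (τ k)) (sym (trans (cong (subST step svar) (renST≡subST suc id (τ k)))
    (subST-subST step svar (var ∘ suc) svar (τ k))))

renF-ext-suc-[v0]ⁿ : ∀ A → (renF (ext suc) id A) [ var zero ]ⁿ ≡ A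
renF-ext-suc-[v0]ⁿ A = trans (cong (subF (consN (var zero) var) svar) (renF≡subF (ext suc) id A))
  (trans (subF-subF _ _ _ _ A) (trans (subF-cong back (λ _ → refl) A) (subF-id A)))
  where
  back : ∀ k → subT (consN (var zero) var) (var (ext suc k)) ≡ var k
  back zero = refl
  back (suc k) = refl

renF-ext-suc-[s0]ˢ : ∀ A → (renF id (ext suc) A) [ svar zero ]ˢ ≡ A
renF-ext-suc-[s0]ˢ A = trans (cong (subF var (consS (svar zero) svar)) (renF≡subF id (ext suc) A))
  (trans (subF-subF _ _ _ _ A) (trans (subF-cong (λ _ → refl) back A) (subF-id A)))
  where
  back : ∀ k → subST var (consS (svar zero) svar) (svar (ext suc k)) ≡ svar k
  back zero = refl
  back (suc k) = refl

Δ₀-subF : ∀ σ τ {φ} → Δ₀ φ → Δ₀ (subF σ τ φ)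
Δ₀-subF σ τ (eqA t s) = eqA _ _
Δ₀-subF σ τ (ltA t s) = ltA _ _
Δ₀-subF σ τ (memA t T) = memA _ _
Δ₀-subF σ τ (uA T) = uA _
Δ₀-subF σ τ botA = botA
Δ₀-subF σ τ (impA d e) = impA (Δ₀-subF σ τ d) (Δ₀-subF σ τ e)
Δ₀-subF σ τ (bddA t {φ} d) =
  subst (λ u → Δ₀ (∀ⁿ ((var zero ≺ u) ⇒ subF (liftNn σ) (liftNs τ) φ)))
        (sym (subT-liftNn-renT-suc σ t)) (bddA (subT σ t) (Δ₀-subF (liftNn σ) (liftNs τ) d))

Δ₀-renF : ∀ ρ π {φ} → Δ₀ φ → Δ₀ (renF ρ π φ)
Δ₀-renF ρ π {φ} d = subst Δ₀ (sym (renF≡subF ρ π φ)) (Δ₀-subF (var ∘ ρ) (svar ∘ π) d)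

⊢-subF : ∀ {φ} → RCA₀U ⊢ φ → ∀ σ τ → RCA₀U ⊢ subF σ τ φ
⊢-subF (ax (basic b1)) σ τ = ax (basic b1)
⊢-subF (ax (basic b2)) σ τ = ax (basic b2)
⊢-subF (ax (basic b3)) σ τ = ax (basic b3)
⊢-subF (ax (basic b4)) σ τ = ax (basic b4)
⊢-subF (ax (basic b5)) σ τ = ax (basic b5)
⊢-subF (ax (basic b6)) σ τ = ax (basic b6)
⊢-subF (ax (basic b7)) σ τ = ax (basic b7)
⊢-subF (ax (basic b8)) σ τ = ax (basic b8)
⊢-subF (ax (pairing (pairAx T t s))) σ τ = ax (pairing (pairAx _ _ _))
⊢-subF (ax (ultra u1)) σ τ = ax (ultra u1)
⊢-subF (ax (ultra u2)) σ τ = ax (ultra u2)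
⊢-subF (ax (ultra u3)) σ τ = ax (ultra u3)
⊢-subF (ax (ultra u4)) σ τ = ax (ultra u4)
⊢-subF (ax (Σ₁-ind {φ} (σ₁ d))) σ τ =
  subst (RCA₀U ⊢_) (sym (cong₂ (λ a b → (a ∧ᶠ ∀ⁿ (φ′ ⇒ b)) ⇒ ∀ⁿ φ′) (subF-[]ⁿ σ τ 𝟘 φ) (subF-succSub σ τ φ)))
        (ax (Σ₁-ind (σ₁ (Δ₀-subF (liftNn (liftNn σ)) (liftNs (liftNs τ)) d))))
  where
  φ′ = subF (liftNn σ) (liftNs τ) φ
⊢-subF (ax (Δ₁-comp {φ} {ψ} (σ₁ d) (π₁ e))) σ τ =
  subst (RCA₀U ⊢_) (sym (cong (λ a → ∀ⁿ (φ′ ⇔ ψ′) ⇒ ∃ˢ (∀ⁿ ((var zero ∈ₛ svar zero) ⇔ a))) (subF-liftN-shiftS σ τ φ)))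
        (ax (Δ₁-comp (σ₁ (Δ₀-subF _ _ d)) (π₁ (Δ₀-subF _ _ e))))
  where
  φ′ = subF (liftNn σ) (liftNs τ) φ
  ψ′ = subF (liftNn σ) (liftNs τ) ψ
⊢-subF (mp p q) σ τ = mp (⊢-subF p σ τ) (⊢-subF q σ τ)
⊢-subF K σ τ = K
⊢-subF S σ τ = S
⊢-subF DNE σ τ = DNE
⊢-subF (genⁿ p) σ τ = genⁿ (⊢-subF p (liftNn σ) (liftNs τ))
⊢-subF (instⁿ {φ} t) σ τ =
  subst (λ a → RCA₀U ⊢ ∀ⁿ (subF (liftNn σ) (liftNs τ) φ) ⇒ a) (sym (subF-[]ⁿ σ τ t φ)) (instⁿ (subT σ t))
⊢-subF (distⁿ {φ} {ψ}) σ τ =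
  subst (λ a → RCA₀U ⊢ ∀ⁿ (a ⇒ subF (liftNn σ) (liftNs τ) φ) ⇒ subF σ τ ψ ⇒ ∀ⁿ (subF (liftNn σ) (liftNs τ) φ))
        (sym (subF-shiftN σ τ ψ)) distⁿ
⊢-subF (genˢ p) σ τ = genˢ (⊢-subF p σ (liftSs τ))
⊢-subF (instˢ {φ} T) σ τ =
  subst (λ a → RCA₀U ⊢ ∀ˢ (subF σ (liftSs τ) φ) ⇒ a) (sym (subF-[]ˢ σ τ T φ)) (instˢ (subST σ τ T))
⊢-subF (distˢ {φ} {ψ}) σ τ =
  subst (λ a → RCA₀U ⊢ ∀ˢ (a ⇒ subF σ (liftSs τ) φ) ⇒ subF σ τ ψ ⇒ ∀ˢ (subF σ (liftSs τ) φ))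
        (sym (subF-shiftS σ τ ψ)) distˢ
⊢-subF (eq-refl t) σ τ = eq-refl _
⊢-subF (eq-subst {φ} t s) σ τ =
  subst₂ (λ a b → RCA₀U ⊢ (subT σ t ≐ subT σ s) ⇒ a ⇒ b) (sym (subF-[]ⁿ σ τ t φ)) (sym (subF-[]ⁿ σ τ s φ))
         (eq-subst (subT σ t) (subT σ s))

infixr 2 _⇒⋆_
infix 0 _⊩_

_⇒⋆_ : List Fm → Fm → Fm
[] ⇒⋆ φ = φ
(h ∷ Δ) ⇒⋆ φ = Δ ⇒⋆ (h ⇒ φ)

-- Hypotheses are discharged into implications, so no deduction theorem for ⊢ is needed.
record _⊩_ (Δ : List Fm) (φ : Fm) : Set where
  constructor ⟨_⟩
  field proof : RCA₀U ⊢ Δ ⇒⋆ φ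
open _⊩_ public

⇒-refl : ∀ {φ} → RCA₀U ⊢ φ ⇒ φ
⇒-refl {φ} = mp (mp S K) (K {ψ = φ})

theorem : ∀ {Δ φ} → RCA₀U ⊢ φ → Δ ⊩ φ
theorem {[]} p = ⟨ p ⟩
theorem {h ∷ Δ} p = ⟨ proof (theorem {Δ} (mp K p)) ⟩

closed : ∀ {φ} → [] ⊩ φ → RCA₀U ⊢ φ
closed = proof

weaken⋆ : ∀ {Δ φ} → [] ⊩ φ → Δ ⊩ φ
weaken⋆ p = theorem (closed p)

⇒E : ∀ {Δ φ ψ} → Δ ⊩ φ ⇒ ψ → Δ ⊩ φ → Δ ⊩ ψ
⇒E {[]} ⟨ p ⟩ ⟨ q ⟩ = ⟨ mp p q ⟩
⇒E {h ∷ Δ} ⟨ p ⟩ ⟨ q ⟩ = ⟨ proof (⇒E {Δ} (⇒E {Δ} (theorem {Δ} S) ⟨ p ⟩) ⟨ q ⟩) ⟩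

⇒I : ∀ {Δ h φ} → (h ∷ Δ) ⊩ φ → Δ ⊩ h ⇒ φ
⇒I ⟨ p ⟩ = ⟨ p ⟩

⇒I⁻¹ : ∀ {Δ h φ} → Δ ⊩ h ⇒ φ → (h ∷ Δ) ⊩ φ
⇒I⁻¹ ⟨ p ⟩ = ⟨ p ⟩

apply : ∀ {Δ φ ψ} → RCA₀U ⊢ φ ⇒ ψ → Δ ⊩ φ → Δ ⊩ ψ
apply p = ⇒E (theorem p)

weaken : ∀ {Δ h φ} → Δ ⊩ φ → (h ∷ Δ) ⊩ φ
weaken p = ⇒I⁻¹ (apply K p)

assume : ∀ {Δ φ} → φ ∈ Δ → Δ ⊩ φ
assume {φ ∷ Δ} (here refl) = ⟨ proof (theorem {Δ} ⇒-refl) ⟩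
assume {ψ ∷ Δ} (there p) = weaken (assume p)

h0 : ∀ {Δ φ} → (φ ∷ Δ) ⊩ φ
h0 = assume (here refl)
h1 : ∀ {Δ φ ψ} → (ψ ∷ φ ∷ Δ) ⊩ φ
h1 = weaken h0
h2 : ∀ {Δ φ ψ χ} → (χ ∷ ψ ∷ φ ∷ Δ) ⊩ φ
h2 = weaken h1
h3 : ∀ {Δ φ ψ χ ω} → (ω ∷ χ ∷ ψ ∷ φ ∷ Δ) ⊩ φ
h3 = weaken h2
h4 : ∀ {Δ φ ψ χ ω ξ} → (ξ ∷ ω ∷ χ ∷ ψ ∷ φ ∷ Δ) ⊩ φ
h4 = weaken h3
h5 : ∀ {Δ φ ψ χ ω ξ ζ} → (ζ ∷ ξ ∷ ω ∷ χ ∷ ψ ∷ φ ∷ Δ) ⊩ φ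
h5 = weaken h4

cut : ∀ {Δ Δ′ φ} → Δ ⊩ φ → (∀ {h} → h ∈ Δ → Δ′ ⊩ h) → Δ′ ⊩ φ
cut {[]} ⟨ p ⟩ f = theorem p
cut {h ∷ Δ} ⟨ p ⟩ f = ⇒E (cut {Δ} ⟨ p ⟩ (f ∘ there)) (f (here refl))

weaken-under : ∀ {Δ φ ψ χ} → (φ ∷ Δ) ⊩ χ → (φ ∷ ψ ∷ Δ) ⊩ χ
weaken-under q = cut q λ { (here refl) → h0 ; (there x) → weaken (weaken (assume x)) }

cast : ∀ {Δ φ ψ} → φ ≡ ψ → Δ ⊩ φ → Δ ⊩ ψ
cast refl p = p

raa : ∀ {Δ φ} → ((¬ᶠ φ) ∷ Δ) ⊩ ⊥ᶠ → Δ ⊩ φ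
raa p = apply DNE (⇒I p)

⊥E : ∀ {Δ φ} → Δ ⊩ ⊥ᶠ → Δ ⊩ φ
⊥E p = raa (weaken p)

¬E : ∀ {Δ φ ψ} → Δ ⊩ φ → Δ ⊩ ¬ᶠ φ → Δ ⊩ ψ
¬E p q = ⊥E (⇒E q p)

∧I : ∀ {Δ φ ψ} → Δ ⊩ φ → Δ ⊩ ψ → Δ ⊩ φ ∧ᶠ ψ
∧I p q = ⇒I (⇒E (⇒E h0 (weaken p)) (weaken q))

∧E₁ : ∀ {Δ φ ψ} → Δ ⊩ φ ∧ᶠ ψ → Δ ⊩ φ
∧E₁ p = raa (⇒E (weaken p) (⇒I (⊥E (⇒E h1 h0))))

∧E₂ : ∀ {Δ φ ψ} → Δ ⊩ φ ∧ᶠ ψ → Δ ⊩ ψ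
∧E₂ p = raa (⇒E (weaken p) (⇒I (weaken h0)))

∨I₁ : ∀ {Δ φ ψ} → Δ ⊩ φ → Δ ⊩ φ ∨ᶠ ψ
∨I₁ p = ⇒I (⊥E (⇒E h0 (weaken p)))

∨I₂ : ∀ {Δ φ ψ} → Δ ⊩ ψ → Δ ⊩ φ ∨ᶠ ψ
∨I₂ p = ⇒I (weaken p)

∨E : ∀ {Δ φ ψ χ} → Δ ⊩ φ ∨ᶠ ψ → (φ ∷ Δ) ⊩ χ → (ψ ∷ Δ) ⊩ χ → Δ ⊩ χ
∨E p q r = raa (⇒E h0 (cut r λ { (here refl) → ⇒E (weaken p) (⇒I (⇒E h1 (weaken-under q)))
                                ; (there x) → weaken (assume x) }))

⇔I : ∀ {Δ φ ψ} → (φ ∷ Δ) ⊩ ψ → (ψ ∷ Δ) ⊩ φ → Δ ⊩ φ ⇔ ψ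
⇔I p q = ∧I (⇒I p) (⇒I q)

⇔-to : ∀ {Δ φ ψ} → Δ ⊩ φ ⇔ ψ → Δ ⊩ φ → Δ ⊩ ψ
⇔-to p = ⇒E (∧E₁ p)

⇔-from : ∀ {Δ φ ψ} → Δ ⊩ φ ⇔ ψ → Δ ⊩ ψ → Δ ⊩ φ
⇔-from p = ⇒E (∧E₂ p)

⇔-trans : ∀ {Δ φ ψ χ} → Δ ⊩ φ ⇔ ψ → Δ ⊩ ψ ⇔ χ → Δ ⊩ φ ⇔ χ
⇔-trans p q = ⇔I (⇔-to (weaken q) (⇔-to (weaken p) h0)) (⇔-from (weaken p) (⇔-from (weaken q) h0))

∀ⁿI : ∀ {Δ φ} → map shiftN Δ ⊩ φ → Δ ⊩ ∀ⁿ φ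
∀ⁿI {[]} ⟨ p ⟩ = ⟨ genⁿ p ⟩
∀ⁿI {h ∷ Δ} ⟨ p ⟩ = ⇒I⁻¹ (⇒E (theorem distⁿ) (∀ⁿI {Δ} ⟨ p ⟩))

∀ⁿE : ∀ {Δ φ} → Δ ⊩ ∀ⁿ φ → ∀ t → Δ ⊩ φ [ t ]ⁿ
∀ⁿE p t = apply (instⁿ t) p

∀ˢI : ∀ {Δ φ} → map shiftS Δ ⊩ φ → Δ ⊩ ∀ˢ φ
∀ˢI {[]} ⟨ p ⟩ = ⟨ genˢ p ⟩
∀ˢI {h ∷ Δ} ⟨ p ⟩ = ⇒I⁻¹ (⇒E (theorem distˢ) (∀ˢI {Δ} ⟨ p ⟩))

∀ˢE : ∀ {Δ φ} → Δ ⊩ ∀ˢ φ → ∀ T → Δ ⊩ φ [ T ]ˢ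
∀ˢE p T = apply (instˢ T) p

∃ⁿI : ∀ {Δ φ} t → Δ ⊩ φ [ t ]ⁿ → Δ ⊩ ∃ⁿ φ
∃ⁿI t p = ⇒I (⇒E (∀ⁿE h0 t) (weaken p))

∃ˢI : ∀ {Δ φ} T → Δ ⊩ φ [ T ]ˢ → Δ ⊩ ∃ˢ φ
∃ˢI T p = ⇒I (⇒E (∀ˢE h0 T) (weaken p))

∃ⁿE : ∀ {Δ φ ψ} → Δ ⊩ ∃ⁿ φ → (φ ∷ map shiftN Δ) ⊩ shiftN ψ → Δ ⊩ ψ
∃ⁿE p q = raa (⇒E (weaken p) (∀ⁿI (⇒I (⇒E h1 (weaken-under q)))))

∃ˢE : ∀ {Δ φ ψ} → Δ ⊩ ∃ˢ φ → (φ ∷ map shiftS Δ) ⊩ shiftS ψ → Δ ⊩ ψ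
∃ˢE p q = raa (⇒E (weaken p) (∀ˢI (⇒I (⇒E h1 (weaken-under q)))))

∀ⁿE-v0 : ∀ {Δ A} → Δ ⊩ renF suc id (∀ⁿ A) → Δ ⊩ A
∀ⁿE-v0 {A = A} p = cast (renF-ext-suc-[v0]ⁿ A) (∀ⁿE p (var zero))

∀ⁿ-mono₁ : ∀ {A B} → [] ⊩ A ⇒ B → [] ⊩ ∀ⁿ A ⇒ ∀ⁿ B
∀ⁿ-mono₁ p = ⇒I (∀ⁿI (apply (closed p) (∀ⁿE-v0 h0)))

∀ⁿ-mono₂ : ∀ {A B C} → [] ⊩ A ⇒ B ⇒ C → [] ⊩ ∀ⁿ A ⇒ ∀ⁿ B ⇒ ∀ⁿ C
∀ⁿ-mono₂ p = ⇒I (⇒I (∀ⁿI (⇒E (apply (closed p) (∀ⁿE-v0 h1)) (∀ⁿE-v0 h0))))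

∀ⁿ-mono₃ : ∀ {A B C D} → [] ⊩ A ⇒ B ⇒ C ⇒ D → [] ⊩ ∀ⁿ A ⇒ ∀ⁿ B ⇒ ∀ⁿ C ⇒ ∀ⁿ D
∀ⁿ-mono₃ p = ⇒I (⇒I (⇒I (∀ⁿI (⇒E (⇒E (apply (closed p) (∀ⁿE-v0 h2)) (∀ⁿE-v0 h1)) (∀ⁿE-v0 h0)))))

∀ⁿ-cong : ∀ {Δ A B} → Δ ⊩ ∀ⁿ (A ⇔ B) → Δ ⊩ ∀ⁿ A ⇔ ∀ⁿ B
∀ⁿ-cong p = ⇔I (⇒E (⇒E (weaken⋆ (∀ⁿ-mono₂ (⇒I (⇒I (⇔-to h1 h0))))) (weaken p)) h0)
               (⇒E (⇒E (weaken⋆ (∀ⁿ-mono₂ (⇒I (⇒I (⇔-from h1 h0))))) (weaken p)) h0)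

∀ⁿ-vacuousI : ∀ {Δ χ} → Δ ⊩ χ → Δ ⊩ ∀ⁿ (shiftN χ)
∀ⁿ-vacuousI = apply (mp distⁿ (genⁿ ⇒-refl))

∀ⁿ-vacuousE : ∀ {Δ χ} → Δ ⊩ ∀ⁿ (shiftN χ) → Δ ⊩ χ
∀ⁿ-vacuousE {χ = χ} p = cast (shiftN-[]ⁿ 𝟘 χ) (∀ⁿE p 𝟘)

∃ⁿ-vacuousI : ∀ {Δ χ} → Δ ⊩ χ → Δ ⊩ ∃ⁿ (shiftN χ)
∃ⁿ-vacuousI {χ = χ} p = ∃ⁿI 𝟘 (cast (sym (shiftN-[]ⁿ 𝟘 χ)) p)

∃ⁿ-vacuousE : ∀ {Δ χ} → Δ ⊩ ∃ⁿ (shiftN χ) → Δ ⊩ χ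
∃ⁿ-vacuousE p = ∃ⁿE p h0

∃ˢ-mono : ∀ {A B} → [] ⊩ A ⇒ B → [] ⊩ ∃ˢ A ⇒ ∃ˢ B
∃ˢ-mono {A} {B} p = ⇒I (∃ˢE h0 (∃ˢI (svar zero) (cast (sym (renF-ext-suc-[s0]ˢ B)) (apply (closed p) h0))))

⊩-shiftS : ∀ {φ} → [] ⊩ φ → [] ⊩ shiftS φ
⊩-shiftS {φ} p = cast (sym (renF≡subF id suc φ)) ⟨ ⊢-subF (closed p) var (svar ∘ suc) ⟩

∀ⁿ⋆ : ℕ → Fm → Fm
∀ⁿ⋆ zero φ = φ
∀ⁿ⋆ (suc n) φ = ∀ⁿ⋆ n (∀ⁿ φ)

∀ⁿ⋆-mono₁ : ∀ n {A B} → [] ⊩ A ⇒ B → [] ⊩ ∀ⁿ⋆ n A ⇒ ∀ⁿ⋆ n B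
∀ⁿ⋆-mono₁ zero p = p
∀ⁿ⋆-mono₁ (suc n) p = ∀ⁿ⋆-mono₁ n (∀ⁿ-mono₁ p)

∀ⁿ⋆-mono₃ : ∀ n {A B C D} → [] ⊩ A ⇒ B ⇒ C ⇒ D → [] ⊩ ∀ⁿ⋆ n A ⇒ ∀ⁿ⋆ n B ⇒ ∀ⁿ⋆ n C ⇒ ∀ⁿ⋆ n D
∀ⁿ⋆-mono₃ zero p = p
∀ⁿ⋆-mono₃ (suc n) p = ∀ⁿ⋆-mono₃ n (∀ⁿ-mono₃ p)

≐-subst : ∀ {Δ t s} → Δ ⊩ t ≐ s → ∀ σ τ ψ → Δ ⊩ subF (consN t σ) τ ψ → Δ ⊩ subF (consN s σ) τ ψ
≐-subst {t = t} {s} t≐s σ τ ψ p =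
  cast (hole-filled s) (⇒E (⇒E (theorem (eq-subst {φ = φ} t s)) t≐s) (cast (sym (hole-filled t)) p))
  where
  φ = subF (consN (var zero) (renT suc ∘ σ)) (renST suc id ∘ τ) ψ
  hole-filled : ∀ u → φ [ u ]ⁿ ≡ subF (consN u σ) τ ψ
  hole-filled u = trans (subF-subF (consN u var) svar _ _ ψ) (subF-cong fill-n (λ k → subST-consN-renST-suc u (τ k)) ψ)
    where
    fill-n : ∀ k → subT (consN u var) (consN (var zero) (renT suc ∘ σ) k) ≡ consN u σ k
    fill-n zero = refl
    fill-n (suc k) = subT-consN-renT-suc u (σ k)

≐-subst₁ : ∀ {Δ t s} → Δ ⊩ t ≐ s → ∀ u σ τ ψ →
           Δ ⊩ subF (consN u (consN t σ)) τ ψ → Δ ⊩ subF (consN u (consN s σ)) τ ψ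
≐-subst₁ {t = t} {s} t≐s u σ τ ψ p = cast (swapped s) (≐-subst t≐s (consN u σ) τ φ (cast (sym (swapped t)) p))
  where
  swap : ℕ → Tm
  swap = consN (var 1) (consN (var 0) (var ∘ suc ∘ suc))
  φ = subF swap svar ψ
  swapped : ∀ w → subF (consN w (consN u σ)) τ φ ≡ subF (consN u (consN w σ)) τ ψ
  swapped w = trans (subF-subF _ _ _ _ ψ) (subF-cong swap-back (λ _ → refl) ψ)
    where
    swap-back : ∀ k → subT (consN w (consN u σ)) (swap k) ≡ consN u (consN w σ) k
    swap-back zero = refl
    swap-back (suc zero) = refl
    swap-back (suc (suc k)) = refl

≐-refl : ∀ {Δ} t → Δ ⊩ t ≐ t
≐-refl t = theorem (eq-refl t)

≐-sym : ∀ {Δ t s} → Δ ⊩ t ≐ s → Δ ⊩ s ≐ t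
≐-sym {t = t} e = ≐-subst e (consN t var) svar (var 0 ≐ var 1) (≐-refl t)

≐-trans : ∀ {Δ t s u} → Δ ⊩ t ≐ s → Δ ⊩ s ≐ u → Δ ⊩ t ≐ u
≐-trans {t = t} p q = ≐-subst q (consN t var) svar (var 1 ≐ var 0) p

⊕-congʳ : ∀ {Δ t s} u → Δ ⊩ t ≐ s → Δ ⊩ t ⊕ u ≐ s ⊕ u
⊕-congʳ {t = t} u e = ≐-subst e (consN t (consN u var)) svar (var 1 ⊕ var 2 ≐ var 0 ⊕ var 2) (≐-refl _)

⊕-congˡ : ∀ {Δ t s} u → Δ ⊩ t ≐ s → Δ ⊩ u ⊕ t ≐ u ⊕ s
⊕-congˡ {t = t} u e = ≐-subst e (consN t (consN u var)) svar (var 2 ⊕ var 1 ≐ var 2 ⊕ var 0) (≐-refl _)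

⊗-congʳ : ∀ {Δ t s} u → Δ ⊩ t ≐ s → Δ ⊩ t ⊗ u ≐ s ⊗ u
⊗-congʳ {t = t} u e = ≐-subst e (consN t (consN u var)) svar (var 1 ⊗ var 2 ≐ var 0 ⊗ var 2) (≐-refl _)

⊗-congˡ : ∀ {Δ t s} u → Δ ⊩ t ≐ s → Δ ⊩ u ⊗ t ≐ u ⊗ s
⊗-congˡ {t = t} u e = ≐-subst e (consN t (consN u var)) svar (var 2 ⊗ var 1 ≐ var 2 ⊗ var 0) (≐-refl _)

≺-congʳ : ∀ {Δ t s u} → Δ ⊩ t ≐ s → Δ ⊩ u ≺ t → Δ ⊩ u ≺ s
≺-congʳ {u = u} e p = ≐-subst e (consN u var) svar (var 1 ≺ var 0) p

≺-congˡ : ∀ {Δ t s u} → Δ ⊩ t ≐ s → Δ ⊩ t ≺ u → Δ ⊩ s ≺ u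
≺-congˡ {u = u} e p = ≐-subst e (consN u var) svar (var 0 ≺ var 1) p

infixr 1 _≐⟨_⟩_
infix 2 _∎ₑ

_≐⟨_⟩_ : ∀ {Δ s u} t → Δ ⊩ t ≐ s → Δ ⊩ s ≐ u → Δ ⊩ t ≐ u
t ≐⟨ p ⟩ q = ≐-trans p q

_∎ₑ : ∀ {Δ} t → Δ ⊩ t ≐ t
t ∎ₑ = ≐-refl t

inst : ∀ {Δ ψ} → [] ⊩ ψ → ∀ σ → Δ ⊩ subF σ svar ψ
inst p σ = theorem (⊢-subF (closed p) σ svar)

∀ⁿ-strip : ∀ {φ} → RCA₀U ⊢ ∀ⁿ φ → RCA₀U ⊢ φ
∀ⁿ-strip {φ} p = subst (RCA₀U ⊢_) instantiated (mp (instⁿ (var zero)) (⊢-subF p (var ∘ suc) svar))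
  where
  back : ∀ k → subT (consN (var zero) var) (liftNn (var ∘ suc) k) ≡ var k
  back zero = refl
  back (suc k) = refl
  instantiated : (subF (liftNn (var ∘ suc)) (liftNs svar) φ) [ var zero ]ⁿ ≡ φ
  instantiated = trans (subF-subF _ _ _ _ φ) (trans (subF-cong back (λ _ → refl) φ) (subF-id φ))

Σ₁-induction : ∀ {θ} → Δ₀ θ → [] ⊩ (∃ⁿ θ) [ 𝟘 ]ⁿ → (∃ⁿ θ ∷ []) ⊩ succSub (∃ⁿ θ) → [] ⊩ ∃ⁿ θ
Σ₁-induction d base step = ⟨ ∀ⁿ-strip (mp (ax (Σ₁-ind (σ₁ d))) (closed (∧I base (∀ⁿI (⇒I step))))) ⟩

-- A Δ₀ formula ψ is Σ₁ in the guise ∃n ψ with n vacuous.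
Δ₀-induction : ∀ {ψ} → Δ₀ ψ → [] ⊩ ψ [ 𝟘 ]ⁿ → (ψ ∷ []) ⊩ succSub ψ → [] ⊩ ψ
Δ₀-induction {ψ} d base step = ∃ⁿ-vacuousE (Σ₁-induction (Δ₀-renF suc id d)
  (cast (cong ∃ⁿ (sym (subF-shiftN (consN 𝟘 var) svar ψ))) (∃ⁿ-vacuousI base))
  (cast (cong ∃ⁿ (sym (subF-shiftN (consN (var zero ⊕ 𝟙) (var ∘ suc)) svar ψ)))
        (∃ⁿ-vacuousI (cut step λ { (here refl) → ∃ⁿ-vacuousE h0 }))))

⊕𝟙≢𝟘 : ∀ {Δ} t → Δ ⊩ ¬ᶠ (t ⊕ 𝟙 ≐ 𝟘)
⊕𝟙≢𝟘 t = inst ⟨ ∀ⁿ-strip (ax (basic b1)) ⟩ (consN t var)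

⊕𝟙-injective : ∀ {Δ t s} → Δ ⊩ t ⊕ 𝟙 ≐ s ⊕ 𝟙 → Δ ⊩ t ≐ s
⊕𝟙-injective {t = t} {s} = ⇒E (inst ⟨ ∀ⁿ-strip (∀ⁿ-strip (ax (basic b2))) ⟩ (consN t (consN s var)))

⊕-identityʳ : ∀ {Δ} t → Δ ⊩ t ⊕ 𝟘 ≐ t
⊕-identityʳ t = inst ⟨ ∀ⁿ-strip (ax (basic b3)) ⟩ (consN t var)

⊕-sucʳ : ∀ {Δ} t s → Δ ⊩ t ⊕ (s ⊕ 𝟙) ≐ (t ⊕ s) ⊕ 𝟙
⊕-sucʳ t s = inst ⟨ ∀ⁿ-strip (∀ⁿ-strip (ax (basic b4))) ⟩ (consN t (consN s var))

⊗-zeroʳ : ∀ {Δ} t → Δ ⊩ t ⊗ 𝟘 ≐ 𝟘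
⊗-zeroʳ t = inst ⟨ ∀ⁿ-strip (ax (basic b5)) ⟩ (consN t var)

⊗-sucʳ : ∀ {Δ} t s → Δ ⊩ t ⊗ (s ⊕ 𝟙) ≐ (t ⊗ s) ⊕ t
⊗-sucʳ t s = inst ⟨ ∀ⁿ-strip (∀ⁿ-strip (ax (basic b6))) ⟩ (consN t (consN s var))

≺-⊕𝟙 : ∀ {Δ} t s → Δ ⊩ (t ≺ s ⊕ 𝟙) ⇔ ((t ≺ s) ∨ᶠ (t ≐ s))
≺-⊕𝟙 t s = inst ⟨ ∀ⁿ-strip (∀ⁿ-strip (ax (basic b8))) ⟩ (consN t (consN s var))

v0 v1 v2 v3 v4 : Tm
v0 = var 0
v1 = var 1
v2 = var 2
v3 = var 3
v4 = var 4

-- The identities below are proved for variables by Δ₀-induction on var 0 and then instantiated.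

⊕-identityˡ : ∀ {Δ} t → Δ ⊩ 𝟘 ⊕ t ≐ t
⊕-identityˡ t = inst open-form (consN t var)
  where
  open-form : [] ⊩ 𝟘 ⊕ v0 ≐ v0
  open-form = Δ₀-induction (eqA _ _) (⊕-identityʳ 𝟘) (≐-trans (⊕-sucʳ 𝟘 v0) (⊕-congʳ 𝟙 h0))

⊕-sucˡ : ∀ {Δ} y x → Δ ⊩ (y ⊕ 𝟙) ⊕ x ≐ (y ⊕ x) ⊕ 𝟙
⊕-sucˡ y x = inst open-form (consN x (consN y var))
  where
  open-form : [] ⊩ (v1 ⊕ 𝟙) ⊕ v0 ≐ (v1 ⊕ v0) ⊕ 𝟙
  open-form = Δ₀-induction (eqA _ _) (≐-trans (⊕-identityʳ _) (⊕-congʳ 𝟙 (≐-sym (⊕-identityʳ _))))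
    (≐-trans (⊕-sucʳ _ _) (≐-trans (⊕-congʳ 𝟙 h0) (⊕-congʳ 𝟙 (≐-sym (⊕-sucʳ _ _)))))

⊕-comm : ∀ {Δ} x y → Δ ⊩ x ⊕ y ≐ y ⊕ x
⊕-comm x y = inst open-form (consN x (consN y var))
  where
  open-form : [] ⊩ v0 ⊕ v1 ≐ v1 ⊕ v0
  open-form = Δ₀-induction (eqA _ _) (≐-trans (⊕-identityˡ _) (≐-sym (⊕-identityʳ _)))
    (≐-trans (⊕-sucˡ _ _) (≐-trans (⊕-congʳ 𝟙 h0) (≐-sym (⊕-sucʳ _ _))))

⊕-assoc : ∀ {Δ} y z x → Δ ⊩ (y ⊕ z) ⊕ x ≐ y ⊕ (z ⊕ x)
⊕-assoc y z x = inst open-form (consN x (consN y (consN z var)))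
  where
  open-form : [] ⊩ (v1 ⊕ v2) ⊕ v0 ≐ v1 ⊕ (v2 ⊕ v0)
  open-form = Δ₀-induction (eqA _ _) (≐-trans (⊕-identityʳ _) (⊕-congˡ _ (≐-sym (⊕-identityʳ _))))
    (≐-trans (⊕-sucʳ _ _) (≐-trans (⊕-congʳ 𝟙 h0)
      (≐-trans (≐-sym (⊕-sucʳ _ _)) (⊕-congˡ _ (≐-sym (⊕-sucʳ _ _))))))

⊕-permuteʳ : ∀ {Δ} x y z → Δ ⊩ (x ⊕ y) ⊕ z ≐ (x ⊕ z) ⊕ y
⊕-permuteʳ x y z = ≐-trans (⊕-assoc x y z) (≐-trans (⊕-congˡ x (⊕-comm y z)) (≐-sym (⊕-assoc x z y)))

⊕-cancelʳ : ∀ {Δ y z x} → Δ ⊩ y ⊕ x ≐ z ⊕ x → Δ ⊩ y ≐ z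
⊕-cancelʳ {y = y} {z} {x} = ⇒E (inst open-form (consN x (consN y (consN z var))))
  where
  open-form : [] ⊩ (v1 ⊕ v0 ≐ v2 ⊕ v0) ⇒ (v1 ≐ v2)
  open-form = Δ₀-induction (impA (eqA _ _) (eqA _ _))
    (⇒I (≐-trans (≐-sym (⊕-identityʳ _)) (≐-trans h0 (⊕-identityʳ _))))
    (⇒I (⇒E h1 (⊕𝟙-injective (≐-trans (≐-sym (⊕-sucʳ _ _)) (≐-trans h0 (⊕-sucʳ _ _))))))

⊕-cancelˡ : ∀ {Δ y z x} → Δ ⊩ x ⊕ y ≐ x ⊕ z → Δ ⊩ y ≐ z
⊕-cancelˡ {y = y} {z} {x} p = ⊕-cancelʳ (≐-trans (⊕-comm y x) (≐-trans p (⊕-comm x z)))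

⊗-zeroˡ : ∀ {Δ} t → Δ ⊩ 𝟘 ⊗ t ≐ 𝟘
⊗-zeroˡ t = inst open-form (consN t var)
  where
  open-form : [] ⊩ 𝟘 ⊗ v0 ≐ 𝟘
  open-form = Δ₀-induction (eqA _ _) (⊗-zeroʳ 𝟘) (≐-trans (⊗-sucʳ _ _) (≐-trans (⊕-identityʳ _) h0))

⊗-sucˡ : ∀ {Δ} y x → Δ ⊩ (y ⊕ 𝟙) ⊗ x ≐ (y ⊗ x) ⊕ x
⊗-sucˡ y x = inst open-form (consN x (consN y var))
  where
  exchange : ∀ {Δ} a x y → Δ ⊩ (a ⊕ x) ⊕ (y ⊕ 𝟙) ≐ (a ⊕ y) ⊕ (x ⊕ 𝟙)
  exchange a x y =
    (a ⊕ x) ⊕ (y ⊕ 𝟙) ≐⟨ ⊕-assoc a x (y ⊕ 𝟙) ⟩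
    a ⊕ (x ⊕ (y ⊕ 𝟙)) ≐⟨ ⊕-congˡ a (⊕-sucʳ x y) ⟩
    a ⊕ ((x ⊕ y) ⊕ 𝟙) ≐⟨ ⊕-congˡ a (⊕-congʳ 𝟙 (⊕-comm x y)) ⟩
    a ⊕ ((y ⊕ x) ⊕ 𝟙) ≐⟨ ⊕-congˡ a (≐-sym (⊕-sucʳ y x)) ⟩
    a ⊕ (y ⊕ (x ⊕ 𝟙)) ≐⟨ ≐-sym (⊕-assoc a y (x ⊕ 𝟙)) ⟩
    (a ⊕ y) ⊕ (x ⊕ 𝟙) ∎ₑ
  open-form : [] ⊩ (v1 ⊕ 𝟙) ⊗ v0 ≐ (v1 ⊗ v0) ⊕ v0
  open-form = Δ₀-induction (eqA _ _) (≐-trans (⊗-zeroʳ _) (≐-sym (≐-trans (⊕-identityʳ _) (⊗-zeroʳ _))))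
    (≐-trans (⊗-sucʳ _ _) (≐-trans (⊕-congʳ _ h0) (≐-trans (exchange _ _ _) (⊕-congʳ _ (≐-sym (⊗-sucʳ _ _))))))

⊗-comm : ∀ {Δ} x y → Δ ⊩ x ⊗ y ≐ y ⊗ x
⊗-comm x y = inst open-form (consN x (consN y var))
  where
  open-form : [] ⊩ v0 ⊗ v1 ≐ v1 ⊗ v0
  open-form = Δ₀-induction (eqA _ _) (≐-trans (⊗-zeroˡ _) (≐-sym (⊗-zeroʳ _)))
    (≐-trans (⊗-sucˡ _ _) (≐-trans (⊕-congʳ _ h0) (≐-sym (⊗-sucʳ _ _))))

⊗-distribˡ-⊕ : ∀ {Δ} y z x → Δ ⊩ y ⊗ (z ⊕ x) ≐ (y ⊗ z) ⊕ (y ⊗ x)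
⊗-distribˡ-⊕ y z x = inst open-form (consN x (consN y (consN z var)))
  where
  open-form : [] ⊩ v1 ⊗ (v2 ⊕ v0) ≐ (v1 ⊗ v2) ⊕ (v1 ⊗ v0)
  open-form = Δ₀-induction (eqA _ _)
    (≐-trans (⊗-congˡ _ (⊕-identityʳ _)) (≐-sym (≐-trans (⊕-congˡ _ (⊗-zeroʳ _)) (⊕-identityʳ _))))
    (≐-trans (⊗-congˡ _ (⊕-sucʳ _ _)) (≐-trans (⊗-sucʳ _ _) (≐-trans (⊕-congʳ _ h0)
      (≐-trans (⊕-assoc _ _ _) (⊕-congˡ _ (≐-sym (⊗-sucʳ _ _)))))))

⊗-distribʳ-⊕ : ∀ {Δ} y z x → Δ ⊩ (y ⊕ z) ⊗ x ≐ (y ⊗ x) ⊕ (z ⊗ x)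
⊗-distribʳ-⊕ y z x = ≐-trans (⊗-comm _ _)
  (≐-trans (⊗-distribˡ-⊕ x y z) (≐-trans (⊕-congʳ _ (⊗-comm x y)) (⊕-congˡ _ (⊗-comm x z))))

≺-⊕-suc : ∀ {Δ} x y → Δ ⊩ x ≺ (x ⊕ y) ⊕ 𝟙
≺-⊕-suc x y = inst open-form (consN y (consN x var))
  where
  open-form : [] ⊩ v1 ≺ (v1 ⊕ v0) ⊕ 𝟙
  open-form = Δ₀-induction (ltA _ _) (⇔-from (≺-⊕𝟙 _ _) (∨I₂ (≐-sym (⊕-identityʳ _))))
    (≺-congʳ (⊕-congʳ 𝟙 (≐-sym (⊕-sucʳ _ _))) (⇔-from (≺-⊕𝟙 _ _) (∨I₁ h0)))

≺-⊕-suc′ : ∀ {Δ} x y → Δ ⊩ x ≺ (y ⊕ x) ⊕ 𝟙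
≺-⊕-suc′ x y = ≺-congʳ (⊕-congʳ 𝟙 (⊕-comm x y)) (≺-⊕-suc x y)

Δ₀-∨ : ∀ {φ ψ} → Δ₀ φ → Δ₀ ψ → Δ₀ (φ ∨ᶠ ψ)
Δ₀-∨ d e = impA (impA d botA) e

-- For x = var 0.
zero-or-suc : [] ⊩ ∃ⁿ ((v1 ≐ 𝟘) ∨ᶠ (v1 ≐ v0 ⊕ 𝟙))
zero-or-suc = Σ₁-induction (Δ₀-∨ (eqA _ _) (eqA _ _)) (∃ⁿI 𝟘 (∨I₁ (≐-refl _))) (∃ⁿI v0 (∨I₂ (≐-refl _)))

-- For x = var 0 and y = var 1: y = x + z + 1, or x = y, or x = y + z + 1.
trichotomy : [] ⊩ ∃ⁿ ((v1 ≐ (v2 ⊕ v0) ⊕ 𝟙) ∨ᶠ ((v2 ≐ v1) ∨ᶠ (v2 ≐ (v1 ⊕ v0) ⊕ 𝟙)))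
trichotomy = Σ₁-induction (Δ₀-∨ (eqA _ _) (Δ₀-∨ (eqA _ _) (eqA _ _)))
  (∃ⁿE (inst zero-or-suc (consN v0 var))
     (∨E h0 (∃ⁿI 𝟘 (∨I₂ (∨I₁ h0)))
            (∃ⁿI v0 (∨I₂ (∨I₂ (≐-trans h0 (⊕-congʳ 𝟙 (≐-sym (⊕-identityˡ _)))))))))
  (∃ⁿE h0
     (∨E h0
       (∃ⁿI (v0 ⊕ 𝟙) (∨I₁ (≐-trans (⊕-congʳ 𝟙 h0) (⊕-congʳ 𝟙 (≐-sym (⊕-sucʳ _ _))))))
       (∨E h0
         (∃ⁿI 𝟘 (∨I₁ (≐-trans (⊕-congʳ 𝟙 (≐-sym h0)) (⊕-congʳ 𝟙 (≐-sym (⊕-identityʳ _))))))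
         (∃ⁿE (inst zero-or-suc (consN v0 var))
           (∨E h0
             (∃ⁿI v0 (∨I₂ (∨I₁ (≐-trans h2 (⊕-congʳ 𝟙 (≐-trans (⊕-congˡ _ h0) (⊕-identityʳ _)))))))
             (∃ⁿI v0 (∨I₂ (∨I₂ (≐-trans h2 (⊕-congʳ 𝟙 (≐-trans (⊕-congˡ _ h0)
                 (≐-trans (⊕-sucʳ _ _) (≐-sym (⊕-sucˡ _ _))))))))))))))

-- With s = a + b and c + d = s + (z + 1), expanding (c + d)² gives (c,d) = (a,b) + (q + b + z + 1).
pair-≢-larger-sum : ∀ {Δ} a b c d z → Δ ⊩ c ⊕ d ≐ ((a ⊕ b) ⊕ z) ⊕ 𝟙 → Δ ⊩ pair a b ≐ pair c d → Δ ⊩ ⊥ᶠ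
pair-≢-larger-sum a b c d z t≐ pair≐ =
  ⇒E (⊕𝟙≢𝟘 (q ⊕ (b ⊕ z))) (≐-sym (≐-trans gap-zero (⊕-sucʳ q (b ⊕ z))))
  where
  s = a ⊕ b
  t = c ⊕ d
  w = z ⊕ 𝟙
  q = (w ⊗ s ⊕ t ⊗ z) ⊕ c
  t≐s+w = ≐-trans t≐ (≐-sym (⊕-sucʳ s z))
  t≐a+rest = ≐-trans t≐ (≐-trans (⊕-congʳ 𝟙 (⊕-assoc a b z)) (≐-sym (⊕-sucʳ a (b ⊕ z))))
  t² = t ⊗ t ≐⟨ ⊗-congˡ t t≐s+w ⟩
       t ⊗ (s ⊕ w) ≐⟨ ⊗-distribˡ-⊕ t s w ⟩
       t ⊗ s ⊕ t ⊗ w ≐⟨ ⊕-congʳ _ (⊗-congʳ s t≐s+w) ⟩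
       (s ⊕ w) ⊗ s ⊕ t ⊗ w ≐⟨ ⊕-congʳ _ (⊗-distribʳ-⊕ s w s) ⟩
       (s ⊗ s ⊕ w ⊗ s) ⊕ t ⊗ w ≐⟨ ⊕-congˡ _ (⊗-sucʳ t z) ⟩
       (s ⊗ s ⊕ w ⊗ s) ⊕ (t ⊗ z ⊕ t) ∎ₑ
  a≐ = ⊕-cancelˡ (≐-trans pair≐
         (≐-trans (⊕-congʳ c t²) (≐-trans (⊕-congʳ c (⊕-assoc _ _ _)) (⊕-assoc _ _ _))))
  rearranged = (w ⊗ s ⊕ (t ⊗ z ⊕ t)) ⊕ c ≐⟨ ⊕-congʳ c (≐-sym (⊕-assoc _ _ _)) ⟩
               ((w ⊗ s ⊕ t ⊗ z) ⊕ t) ⊕ c ≐⟨ ⊕-permuteʳ _ _ _ ⟩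
               q ⊕ t ≐⟨ ⊕-congˡ q t≐a+rest ⟩
               q ⊕ (a ⊕ ((b ⊕ z) ⊕ 𝟙)) ≐⟨ ≐-sym (⊕-assoc _ _ _) ⟩
               (q ⊕ a) ⊕ ((b ⊕ z) ⊕ 𝟙) ≐⟨ ⊕-congʳ _ (⊕-comm _ _) ⟩
               (a ⊕ q) ⊕ ((b ⊕ z) ⊕ 𝟙) ≐⟨ ⊕-assoc _ _ _ ⟩
               a ⊕ (q ⊕ ((b ⊕ z) ⊕ 𝟙)) ∎ₑ
  gap-zero = ⊕-cancelˡ (≐-trans (⊕-identityʳ a) (≐-trans a≐ rearranged))

pair-injective : ∀ {Δ a b c d} → Δ ⊩ pair a b ≐ pair c d → Δ ⊩ (a ≐ c) ∧ᶠ (b ≐ d)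
pair-injective {a = a} {b} {c} {d} = ⇒E (inst open-form (consN a (consN b (consN c (consN d var)))))
  where
  equal-sum : ∀ {Δ} a b c d → Δ ⊩ a ⊕ b ≐ c ⊕ d → Δ ⊩ pair a b ≐ pair c d → Δ ⊩ (a ≐ c) ∧ᶠ (b ≐ d)
  equal-sum a b c d sum≐ pair≐ = ∧I a≐c (⊕-cancelˡ (≐-trans sum≐ (⊕-congʳ d (≐-sym a≐c))))
    where
    a≐c = ⊕-cancelˡ (≐-trans pair≐ (⊕-congʳ c
            (≐-trans (⊗-congʳ (c ⊕ d) (≐-sym sum≐)) (⊗-congˡ (a ⊕ b) (≐-sym sum≐)))))
  open-form : [] ⊩ (pair v0 v1 ≐ pair v2 v3) ⇒ ((v0 ≐ v2) ∧ᶠ (v1 ≐ v3))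
  open-form = ⇒I (∃ⁿE (inst trichotomy (consN (v2 ⊕ v3) (consN (v0 ⊕ v1) var)))
    (∨E h0
      (⊥E (pair-≢-larger-sum v1 v2 v3 v4 v0 h0 h2))
      (∨E h0
        (equal-sum v1 v2 v3 v4 h0 h3)
        (⊥E (pair-≢-larger-sum v3 v4 v1 v2 v0 h0 (≐-sym h3))))))

pair-bound₁ : ∀ {Δ} a b → Δ ⊩ a ≺ pair a b ⊕ 𝟙
pair-bound₁ a b = ≺-⊕-suc′ a ((a ⊕ b) ⊗ (a ⊕ b))

pair-bound₂ : ∀ {Δ} a b → Δ ⊩ b ≺ pair a b ⊕ 𝟙
pair-bound₂ a b = inst open-form (consN a (consN b var))
  where
  s = v1 ⊕ v2
  p = s ⊗ (v1 ⊕ v0)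
  expand : ∀ {Δ} → ((v2 ≐ v0 ⊕ 𝟙) ∷ Δ) ⊩ pair v1 v2 ≐ ((p ⊕ v1) ⊕ v1) ⊕ v2
  expand = s ⊗ s ⊕ v1 ≐⟨ ⊕-congʳ v1 (⊗-congˡ s (≐-trans (⊕-congˡ v1 h0) (⊕-sucʳ v1 v0))) ⟩
           s ⊗ ((v1 ⊕ v0) ⊕ 𝟙) ⊕ v1 ≐⟨ ⊕-congʳ v1 (⊗-sucʳ _ _) ⟩
           (p ⊕ s) ⊕ v1 ≐⟨ ⊕-permuteʳ _ _ _ ⟩
           (p ⊕ v1) ⊕ s ≐⟨ ≐-sym (⊕-assoc _ _ _) ⟩
           ((p ⊕ v1) ⊕ v1) ⊕ v2 ∎ₑ
  open-form : [] ⊩ v1 ≺ pair v0 v1 ⊕ 𝟙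
  open-form = ∃ⁿE (inst zero-or-suc (consN v1 var))
    (∨E h0
      (≺-congˡ (≐-sym h0) (≺-congʳ (⊕-congʳ 𝟙 (⊕-identityˡ _)) (≺-⊕-suc 𝟘 (pair v1 v2))))
      (≺-congʳ (⊕-congʳ 𝟙 (≐-sym expand)) (≺-⊕-suc′ v2 ((p ⊕ v1) ⊕ v1))))

∃< : Tm → Fm → Fm
∃< t φ = ¬ᶠ ∀ⁿ ((var zero ≺ renT suc t) ⇒ ¬ᶠ φ)

Δ₀-∃< : ∀ t {φ} → Δ₀ φ → Δ₀ (∃< t φ)
Δ₀-∃< t d = impA (bddA t (impA d botA)) botA

Δ₀-∧ : ∀ {φ ψ} → Δ₀ φ → Δ₀ ψ → Δ₀ (φ ∧ᶠ ψ)
Δ₀-∧ d e = impA (impA d (impA e botA)) botA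

∃<I : ∀ {Δ t φ} u → Δ ⊩ u ≺ t → Δ ⊩ φ [ u ]ⁿ → Δ ⊩ ∃< t φ
∃<I {t = t} u u<t p =
  ⇒I (⇒E (⇒E (cast (cong (λ a → (_ ≺ a) ⇒ _) (subT-consN-renT-suc u t)) (∀ⁿE h0 u)) (weaken u<t)) (weaken p))

∃<E : ∀ {Δ t φ ψ} → Δ ⊩ ∃< t φ → (φ ∷ (var zero ≺ renT suc t) ∷ map shiftN Δ) ⊩ shiftN ψ → Δ ⊩ ψ
∃<E p q = raa (⇒E (weaken p) (∀ⁿI (⇒I (⇒I (⇒E h2 (cut q λ
  { (here refl) → h0 ; (there (here refl)) → h1 ; (there (there x)) → weaken (weaken (weaken (assume x))) }))))))

decoded-vars : ℕ → Tm
decoded-vars = consN v0 (consN v1 (var ∘ suc ∘ suc ∘ suc ∘ suc))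

-- For χ(x, y) with x = var 1 and y = var 0: ∃ x′ < (x,y) + 1 . ∃ y′ < (x,y) + 1 . (x,y) = (x′,y′) ∧ χ(x′, y′).
Decoded : Fm → Fm
Decoded χ = ∃< (pair v1 v0 ⊕ 𝟙) (∃< (pair v2 v1 ⊕ 𝟙) ((pair v3 v2 ≐ pair v1 v0) ∧ᶠ subF decoded-vars svar χ))

decode : ∀ χ → [] ⊩ Decoded χ ⇔ χ
decode χ = ⇔I decoded⇒χ χ⇒decoded
  where
  rewritten : subF (consN v2 (consN v3 (var ∘ suc ∘ suc ∘ suc ∘ suc))) svar χ ≡ shiftN (shiftN χ)
  rewritten = sym (trans (cong shiftN (renF≡subF suc id χ)) (trans (renF≡subF suc id _)
                (trans (subF-subF _ _ _ _ χ) (subF-cong shifted (λ _ → refl) χ))))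
    where
    shifted : ∀ k → subT (var ∘ suc) (var (suc k)) ≡ consN v2 (consN v3 (var ∘ suc ∘ suc ∘ suc ∘ suc)) k
    shifted zero = refl
    shifted (suc zero) = refl
    shifted (suc (suc k)) = refl
  decoded⇒χ : (Decoded χ ∷ []) ⊩ χ
  decoded⇒χ = ∃<E h0 (∃<E h0 (cast rewritten
    (≐-subst₁ (≐-sym (∧E₁ (pair-injective (∧E₁ h0)))) v2 _ svar χ
      (≐-subst (≐-sym (∧E₂ (pair-injective (∧E₁ h0)))) _ svar χ (∧E₂ h0)))))
  instantiated : ((pair v2 v1 ≐ pair v2 v0) ∧ᶠ subF (liftNn (consN v1 var)) svar (subF decoded-vars svar χ)) [ v0 ]ⁿ
                 ≡ ((pair v1 v0 ≐ pair v1 v0) ∧ᶠ χ)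
  instantiated = cong ((pair v1 v0 ≐ pair v1 v0) ∧ᶠ_)
    (trans (subF-subF _ _ _ _ _) (trans (subF-subF _ _ _ _ χ) (trans (subF-cong back (λ _ → refl) χ) (subF-id χ))))
    where
    back : ∀ k → subT (subT (consN v0 var) ∘ liftNn (consN v1 var)) (decoded-vars k) ≡ var k
    back zero = refl
    back (suc zero) = refl
    back (suc (suc k)) = refl
  χ⇒decoded : (χ ∷ []) ⊩ Decoded χ
  χ⇒decoded = ∃<I v1 (pair-bound₁ v1 v0) (∃<I v0 (pair-bound₂ v1 v0) (cast (sym instantiated) (∧I (≐-refl _) h0)))

sections : STm → (ℕ → Tm) → ℕ → STm
sections X f zero = X
sections X f (suc N) = sections X (f ∘ suc) N at f 0

subST-sections : ∀ σ τ X f N → subST σ τ (sections X f N) ≡ sections (subST σ τ X) (subT σ ∘ f) N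
subST-sections σ τ X f zero = refl
subST-sections σ τ X f (suc N) = cong (_at subT σ (f 0)) (subST-sections σ τ X (f ∘ suc) N)

renST-sections : ∀ ρ π X f N → renST ρ π (sections X f N) ≡ sections (renST ρ π X) (renT ρ ∘ f) N
renST-sections ρ π X f zero = refl
renST-sections ρ π X f (suc N) = cong (_at renT ρ (f 0)) (renST-sections ρ π X (f ∘ suc) N)

-- y ∈ (X_{x_N})…_{x₁}, where y = var 0 and xᵢ = var i.
Member : STm → ℕ → Fm
Member X N = var 0 ∈ₛ sections X (var ∘ suc) N

Defines : STm → Fm → ℕ → Fm
Defines X φ N = ∀ⁿ⋆ (suc N) (Member X N ⇔ φ)

-- χ is Σ⁰₁ and Π⁰₁ through a vacuous quantifier, so Δ⁰₁ comprehension applies.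
Δ₀-comprehension₀ : ∀ {χ} → Δ₀ χ → [] ⊩ ∃ˢ (Defines (svar 0) (shiftS χ) 0)
Δ₀-comprehension₀ {χ} d =
  ⇒E (∃ˢ-mono (∀ⁿ-mono₁ (⇒I (⇔-trans h0 unshift)))) (⇒E (theorem (ax (Δ₁-comp (σ₁ d′) (π₁ d′)))) Σ⇔Π)
  where
  d′ = Δ₀-renF suc id d
  Σ⇔Π : [] ⊩ ∀ⁿ (∃ⁿ (shiftN χ) ⇔ ∀ⁿ (shiftN χ))
  Σ⇔Π = ∀ⁿI (⇔I (∀ⁿ-vacuousI (∃ⁿ-vacuousE h0)) (∃ⁿ-vacuousI (∀ⁿ-vacuousE h0)))
  unshift : ∀ {Δ} → Δ ⊩ shiftS (∃ⁿ (shiftN χ)) ⇔ shiftS χ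
  unshift = weaken⋆ (⊩-shiftS (⇔I (∃ⁿ-vacuousE h0) (∃ⁿ-vacuousI h0)))

-- var 0 codes a pair (x, y) with χ(x, y).
Coded : Fm → Fm
Coded χ = ∃< (v0 ⊕ 𝟙) (∃< (v1 ⊕ 𝟙) ((v2 ≐ pair v1 v0) ∧ᶠ renF (ext (ext suc)) id χ))

Δ₀-Coded : ∀ {χ} → Δ₀ χ → Δ₀ (Coded χ)
Δ₀-Coded d = Δ₀-∃< (v0 ⊕ 𝟙) (Δ₀-∃< (v1 ⊕ 𝟙) (Δ₀-∧ (eqA _ _) (Δ₀-renF (ext (ext suc)) id d)))

code-pair : ℕ → Tm
code-pair = consN (pair v1 v0) (var ∘ suc ∘ suc)

subF-Coded : ∀ χ → subF code-pair svar (Coded χ) ≡ Decoded χ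
subF-Coded χ = cong (λ a → ∃< (pair v1 v0 ⊕ 𝟙) (∃< (pair v2 v1 ⊕ 𝟙) ((pair v3 v2 ≐ pair v1 v0) ∧ᶠ a)))
  (trans (cong (subF _ _) (renF≡subF (ext (ext suc)) id χ)) (trans (subF-subF _ _ _ _ χ) (subF-cong vars (λ _ → refl) χ)))
  where
  vars : ∀ k → _ ≡ decoded-vars k
  vars zero = refl
  vars (suc zero) = refl
  vars (suc (suc k)) = refl

-- The pairing axiom y ∈ X_x ↔ (x,y) ∈ X trades the last parameter x for a coded pair.
uncode-sections : ∀ χ N →
  [] ⊩ ∀ⁿ (Member (svar 0) N ⇔ shiftS (Coded χ)) ⇒ ∀ⁿ (∀ⁿ (Member (svar 0) (suc N) ⇔ shiftS χ))
uncode-sections χ N = ⇒I (∀ⁿI (∀ⁿI (⇔-trans (theorem (ax (pairing (pairAx X v1 v0))))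
  (⇔-trans (cast at-pair (∀ⁿE h0 (pair v1 v0))) (weaken⋆ (⊩-shiftS (decode χ)))))))
  where
  X = sections (svar 0) (var ∘ suc ∘ suc) N
  at-code : ∀ B → (renF (ext suc) id (renF (ext suc) id B)) [ pair v1 v0 ]ⁿ ≡ subF code-pair svar B
  at-code B = trans (cong (subF (consN (pair v1 v0) var) svar)
                      (trans (renF≡subF (ext suc) id _) (cong (subF _ _) (renF≡subF (ext suc) id B))))
    (trans (subF-subF _ _ _ _ _) (trans (subF-subF _ _ _ _ B) (subF-cong code (λ _ → refl) B)))
    where
    code : ∀ k → _ ≡ code-pair k
    code zero = refl
    code (suc k) = refl
  at-pair : (renF (ext suc) id (renF (ext suc) id (Member (svar 0) N ⇔ shiftS (Coded χ)))) [ pair v1 v0 ]ⁿ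
            ≡ ((pair v1 v0 ∈ₛ X) ⇔ shiftS (Decoded χ))
  at-pair = trans (at-code (Member (svar 0) N ⇔ shiftS (Coded χ))) (cong₂ (λ a b → (pair v1 v0 ∈ₛ a) ⇔ b)
    (subST-sections code-pair svar (svar 0) (var ∘ suc) N)
    (trans (subF-cong (λ _ → refl) liftSs-svar (shiftS (Coded χ)))
      (trans (subF-shiftS code-pair svar (Coded χ)) (cong shiftS (subF-Coded χ)))))
    where
    liftSs-svar : ∀ k → svar k ≡ liftSs svar k
    liftSs-svar zero = refl
    liftSs-svar (suc k) = refl

Δ₀-comprehension : ∀ {χ} → Δ₀ χ → ∀ N → [] ⊩ ∃ˢ (Defines (svar 0) (shiftS χ) N)
Δ₀-comprehension d zero = Δ₀-comprehension₀ d
Δ₀-comprehension {χ} d (suc N) =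
  ⇒E (∃ˢ-mono (∀ⁿ⋆-mono₁ N (uncode-sections χ N))) (Δ₀-comprehension (Δ₀-Coded d) N)

-- With W = svar 1 and X = svar 0: W = {n ∣ ∃ m < n . m ∉ X}.
FailuresBelow : Fm
FailuresBelow = ∀ⁿ ((v0 ∈ₛ svar 1) ⇔ ∃< v0 (¬ᶠ (v0 ∈ₛ svar 0)))

-- If X fails at m, the complement of W lies in [0, m], so by axiom (1) it is not in 𝔘 and by (4)
-- W is; if X never fails, W = ∅, which is not in 𝔘 by (1).
𝔘-decides-∀ : [] ⊩ FailuresBelow ⇒ ((¬ᶠ 𝔘∋ svar 1) ⇔ ∀ⁿ (v0 ∈ₛ svar 0))
𝔘-decides-∀ = ⇒I (⇔I W∉𝔘⇒∀ ∀⇒W∉𝔘)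
  where
  W∉𝔘⇒∀ : ((¬ᶠ 𝔘∋ svar 1) ∷ FailuresBelow ∷ []) ⊩ ∀ⁿ (v0 ∈ₛ svar 0)
  W∉𝔘⇒∀ = ∀ⁿI (raa (∨E (∀ˢE (theorem (ax (ultra u4))) (svar 1)) (¬E h0 h2)
    (∃ˢE (weaken⋆ (Δ₀-comprehension {¬ᶠ (v0 ∈ₛ svar 1)} (impA (memA _ _) botA) 0))
      (∃ⁿE (∀ⁿE (⇒E (∀ˢE (theorem (ax (ultra u1))) (svar 0)) (⇒E (∀ˢE h1 (svar 0)) h0)) v0)
        (¬E (⇔-from (∀ⁿE h5 v0) (∃<I v1 (∧E₁ h0) h3)) (⇔-to (∀ⁿE h1 v0) (∧E₂ h0)))))))
  ∀⇒W∉𝔘 : (∀ⁿ (v0 ∈ₛ svar 0) ∷ FailuresBelow ∷ []) ⊩ ¬ᶠ 𝔘∋ svar 1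
  ∀⇒W∉𝔘 = ⇒I (∃ⁿE (∀ⁿE (⇒E (∀ˢE (theorem (ax (ultra u1))) (svar 1)) h0) 𝟘)
    (∃<E (⇔-to (∀ⁿE h3 v0) (∧E₂ h0)) (¬E (∀ⁿE h4 v0) h0)))

renS : (ℕ → ℕ) → Fm → Fm
renS π = subF var (svar ∘ π)

renS-renS : ∀ π′ π φ → renS π′ (renS π φ) ≡ renS (π′ ∘ π) φ
renS-renS π′ π φ = trans (subF-subF _ _ _ _ φ) (subF-cong (λ _ → refl) (λ _ → refl) φ)

renS-∀ⁿ : ∀ π φ → renS π (∀ⁿ φ) ≡ ∀ⁿ (renS π φ)
renS-∀ⁿ π φ = cong ∀ⁿ (subF-cong liftNn-var (λ _ → refl) φ)
  where
  liftNn-var : ∀ k → liftNn var k ≡ var k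
  liftNn-var zero = refl
  liftNn-var (suc k) = refl

renS-∀ⁿ⋆ : ∀ π n φ → renS π (∀ⁿ⋆ n φ) ≡ ∀ⁿ⋆ n (renS π φ)
renS-∀ⁿ⋆ π zero φ = refl
renS-∀ⁿ⋆ π (suc n) φ = trans (renS-∀ⁿ⋆ π n (∀ⁿ φ)) (cong (∀ⁿ⋆ n) (renS-∀ⁿ π φ))

renS-Defines : ∀ π j φ N → renS π (Defines (svar j) φ N) ≡ Defines (svar (π j)) (renS π φ) N
renS-Defines π j φ N = trans (renS-∀ⁿ⋆ π (suc N) _)
  (cong (λ X → ∀ⁿ⋆ (suc N) ((var 0 ∈ₛ X) ⇔ renS π φ)) (subST-sections var (svar ∘ π) (svar j) (var ∘ suc) N))

renS-Defines-shiftS : ∀ π φ N → renS π (Defines (svar 0) (shiftS φ) N) ≡ Defines (svar (π 0)) (renS (π ∘ suc) φ) N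
renS-Defines-shiftS π φ N = trans (renS-Defines π 0 (shiftS φ) N)
  (cong (λ a → Defines (svar (π 0)) a N) (trans (cong (renS π) (renF≡subF id suc φ)) (renS-renS π suc φ)))

-- Three successive witnesses, the later ones may depend on the earlier ones
-- (in B the first witness is svar 1, in C the first two are svar 2 and svar 1).
∃ˢ-elim₃ : ∀ {A B C D} → [] ⊩ ∃ˢ A → [] ⊩ ∃ˢ B → [] ⊩ ∃ˢ C →
           [] ⊩ renS (suc ∘ suc) A ⇒ renS suc B ⇒ C ⇒ renS (ext (suc ∘ suc)) D → [] ⊩ ∃ˢ D
∃ˢ-elim₃ {A} {B} {C} {D} ∃A ∃B ∃C combine = ∃ˢE ∃A (∃ˢE (weaken⋆ ∃B) (∃ˢE (weaken⋆ ∃C)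
  (∃ˢI (svar 0) (cast witnessed (⇒E (⇒E (⇒E (weaken⋆ combine) (cast A₂ h2)) (cast B₁ h1)) h0)))))
  where
  A₂ : shiftS (shiftS A) ≡ renS (suc ∘ suc) A
  A₂ = trans (renF≡subF id suc _) (trans (cong (renS suc) (renF≡subF id suc A)) (renS-renS suc suc A))
  B₁ : shiftS B ≡ renS suc B
  B₁ = renF≡subF id suc B
  lower : ∀ k → svar (ext (suc ∘ suc) k) ≡ subST var (consS (svar 0) svar) (svar (ext suc (ext suc (ext suc k))))
  lower zero = refl
  lower (suc k) = refl
  witnessed : renS (ext (suc ∘ suc)) D ≡ (renF id (ext suc) (renF id (ext suc) (renF id (ext suc) D))) [ svar 0 ]ˢ
  witnessed = sym (trans (cong (subF var (consS (svar 0) svar))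
    (trans (renF≡subF id (ext suc) _) (trans (cong (renS (ext suc)) (trans (renF≡subF id (ext suc) _)
      (trans (cong (renS (ext suc)) (renF≡subF id (ext suc) D)) (renS-renS _ _ D)))) (renS-renS _ _ D))))
    (trans (subF-subF _ _ _ _ D) (subF-cong (λ _ → refl) (sym ∘ lower) D)))

Comprehensible : Fm → Set
Comprehensible φ = ∀ N → [] ⊩ ∃ˢ (Defines (svar 0) (shiftS φ) N)

suc³ : ℕ → ℕ
suc³ = suc ∘ suc ∘ suc

comprehensible-⇒ : ∀ {φ ψ} → Comprehensible φ → Comprehensible ψ → Comprehensible (φ ⇒ ψ)
comprehensible-⇒ {φ} {ψ} cφ cψ N =
  ∃ˢ-elim₃ (cφ N) (⊩-shiftS (cψ N)) (Δ₀-comprehension {χ} (impA (memA _ _) (memA _ _)) N)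
  (cast (sym (cong₂ _⇒_ (renS-Defines-shiftS (suc ∘ suc) φ N) (cong₂ _⇒_ ψ-side (cong₂ _⇒_ χ-side
          (renS-Defines-shiftS (ext (suc ∘ suc)) (φ ⇒ ψ) N)))))
        (weaken⋆ (∀ⁿ⋆-mono₃ (suc N) (⇒I (⇒I (⇒I (⇔I
          (⇒I (⇔-to h3 (⇒E (⇔-to h2 h1) (⇔-from h4 h0))))
          (⇔-from h1 (⇒I (⇔-from h3 (⇒E h1 (⇔-to h4 h0))))))))))))
  where
  χ = Member (svar 1) N ⇒ Member (svar 0) N
  ψ-side : renS suc (renF id (ext suc) (Defines (svar 0) (shiftS ψ) N)) ≡ Defines (svar 1) (renS suc³ ψ) N
  ψ-side = trans (cong (renS suc) (renF≡subF id (ext suc) _)) (trans (renS-renS suc (ext suc) _)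
             (renS-Defines-shiftS (suc ∘ ext suc) ψ N))
  χ-side : Defines (svar 0) (shiftS χ) N ≡ Defines (svar 0) (Member (svar 2) N ⇒ Member (svar 1) N) N
  χ-side = cong₂ (λ a b → Defines (svar 0) ((var 0 ∈ₛ a) ⇒ (var 0 ∈ₛ b)) N)
             (renST-sections id suc (svar 1) (var ∘ suc) N) (renST-sections id suc (svar 0) (var ∘ suc) N)

cong₃ : ∀ {A B C D : Set} (f : A → B → C → D) {a a′ b b′ c c′} → a ≡ a′ → b ≡ b′ → c ≡ c′ → f a b c ≡ f a′ b′ c′
cong₃ f refl refl refl = refl

-- From X for φ, form W_x⃗ = {n ∣ ∃ m < n . m ∉ X_x⃗} and Z = {x⃗ ∣ W_x⃗ ∉ 𝔘}; Z is the set for ∀ⁿ φ.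
comprehensible-∀ⁿ : ∀ {φ} → Comprehensible φ → Comprehensible (∀ⁿ φ)
comprehensible-∀ⁿ {φ} cφ N = ∃ˢ-elim₃ (cφ (suc N))
  (Δ₀-comprehension {failures (svar 0)} (Δ₀-∃< v0 (impA (memA _ _) botA)) (suc N))
  (Δ₀-comprehension {¬ᶠ 𝔘∋ sections (svar 0) var (suc N)} (impA (uA _) botA) N)
  (cast (sym (cong₂ _⇒_ (renS-Defines-shiftS (suc ∘ suc) φ (suc N)) (cong₂ _⇒_ W-side (cong₂ _⇒_ Z-side ∀-side))))
        (weaken⋆ (∀ⁿ⋆-mono₃ (suc N) (⇒I (⇒I (⇒I
          (⇔-trans h0 (⇔-trans (apply (closed 𝔘-decides-∀ᵢ) h1) (∀ⁿ-cong h2)))))))))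
  where
  failures : STm → Fm
  failures X = ∃< v0 (¬ᶠ (v0 ∈ₛ sections X (var ∘ suc ∘ suc) (suc N)))
  W = sections (svar 1) var (suc N)
  X = sections (svar 2) var (suc N)
  W-side : renS suc (Defines (svar 0) (shiftS (failures (svar 0))) (suc N)) ≡ Defines (svar 1) (failures (svar 2)) (suc N)
  W-side = trans (renS-Defines-shiftS suc _ (suc N)) (cong (λ a → Defines (svar 1) (∃< v0 (¬ᶠ (v0 ∈ₛ a))) (suc N))
    (subST-sections (liftNn var) (liftNs (svar ∘ suc ∘ suc)) (svar 0) (var ∘ suc ∘ suc) (suc N)))
  Z-side : Defines (svar 0) (shiftS (¬ᶠ 𝔘∋ sections (svar 0) var (suc N))) N ≡ Defines (svar 0) (¬ᶠ 𝔘∋ W) N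
  Z-side = cong (λ a → Defines (svar 0) (¬ᶠ 𝔘∋ a) N) (renST-sections id suc (svar 0) var (suc N))
  ∀-side : renS (ext (suc ∘ suc)) (Defines (svar 0) (shiftS (∀ⁿ φ)) N) ≡ Defines (svar 0) (∀ⁿ (renS suc³ φ)) N
  ∀-side = trans (renS-Defines-shiftS (ext (suc ∘ suc)) (∀ⁿ φ) N)
                 (cong (λ a → Defines (svar 0) a N) (renS-∀ⁿ suc³ φ))
  X↑ : renST suc id X ≡ sections (svar 2) (var ∘ suc) (suc N)
  X↑ = renST-sections suc id (svar 2) var (suc N)
  𝔘-decides-∀ᵢ : [] ⊩ ∀ⁿ (Member (svar 1) (suc N) ⇔ failures (svar 2))
                     ⇒ ((¬ᶠ 𝔘∋ W) ⇔ ∀ⁿ (Member (svar 2) (suc N)))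
  𝔘-decides-∀ᵢ = cast
    (cong₃ (λ a b c → ∀ⁿ ((v0 ∈ₛ a) ⇔ ∃< v0 (¬ᶠ (v0 ∈ₛ b))) ⇒ ((¬ᶠ 𝔘∋ W) ⇔ ∀ⁿ (v0 ∈ₛ c)))
      (renST-sections suc id (svar 1) var (suc N))
      (trans (cong (renST suc id) X↑) (renST-sections suc id (svar 2) (var ∘ suc) (suc N)))
      X↑)
    ⟨ ⊢-subF (closed 𝔘-decides-∀) var (consS X (consS W svar)) ⟩

arithmetical-comprehensible : ∀ {φ} → Arith φ → Comprehensible φ
arithmetical-comprehensible (eqA t s) = Δ₀-comprehension (eqA t s)
arithmetical-comprehensible (ltA t s) = Δ₀-comprehension (ltA t s)
arithmetical-comprehensible (memA t T) = Δ₀-comprehension (memA t T)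
arithmetical-comprehensible (uA T) = Δ₀-comprehension (uA T)
arithmetical-comprehensible botA = Δ₀-comprehension botA
arithmetical-comprehensible (impA a b) = comprehensible-⇒ (arithmetical-comprehensible a) (arithmetical-comprehensible b)
arithmetical-comprehensible (allA a) = comprehensible-∀ⁿ (arithmetical-comprehensible a)

set-induction : [] ⊩ ((𝟘 ∈ₛ svar zero) ∧ᶠ ∀ⁿ ((var zero ∈ₛ svar zero) ⇒ (var zero ⊕ 𝟙 ∈ₛ svar zero)))
                     ⇒ ∀ⁿ (var zero ∈ₛ svar zero)
set-induction = ⇒I (⇒E (weaken⋆ (∀ⁿ-mono₁ (⇒I (∃ⁿ-vacuousE h0))))
  (⇒E (theorem (ax (Σ₁-ind (σ₁ (memA v1 (svar 0))))))
    (∧I (∃ⁿ-vacuousI (∧E₁ h0)) (∀ⁿI (⇒I (∃ⁿ-vacuousI (⇒E (∀ⁿE (∧E₂ h1) v0) (∃ⁿ-vacuousE h0))))))))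

mainTheorem1 : ∀ (φ : Fm) → ACA₀U φ → RCA₀U ⊢ φ
mainTheorem1 φ (basic b) = ax (basic b)
mainTheorem1 φ (pairing p) = ax (pairing p)
mainTheorem1 φ (ultra u) = ax (ultra u)
mainTheorem1 φ set-ind = genˢ (closed set-induction)
mainTheorem1 φ (arith-comp a) = closed (arithmetical-comprehensible a 0)
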